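{- For any integers $n\ge 0$ and $\alpha\ge 1$, we have \[\mathrm{pod}\Big(5^{2\alpha+2}n+\frac{11\cdot 5^{2\alpha+1}+1}{8}\Big)\equiv 0\pmod 5\] and \[\mathrm{pod}\Big(5^{2\alpha+2}n+\frac{19\cdot 5^{2\alpha+1}+1}{8}\Big)\equiv 0\pmod 5.\]
   Context: For an integer $n\ge 0$, $\mathrm{pod}(n)$ denotes the number of partitions of $n$ in which the odd parts are distinct (even parts may repeat); equivalently $\sum_{n\ge 0}\mathrm{pod}(n)q^n=\prod_{i\ge 1}\frac{1+q^{2i-1}}{1-q^{2i}}$. -}

module Defs where

open import Data.Empty using (⊥-elim)
open import Data.List.Base
  using (List; []; _∷_; _++_; concatMap; filter; length; map; replicate; sum; upTo)
open import Data.List.Membership.Propositional using (_∈_; lose; find)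
open import Data.List.Membership.Propositional.Properties
  using (∈-concatMap⁺; ∈-concatMap⁻; ∈-filter⁺; ∈-filter⁻; ∈-map⁺; ∈-map⁻;
         ∈-upTo⁺; ∈-upTo⁻)
open import Data.List.Properties using (++-cancelˡ; ∷-injectiveˡ; ∷-injectiveʳ)
open import Data.List.Relation.Unary.All as All using (All; []; _∷_)
open import Data.List.Relation.Unary.All.Properties as All using ()
open import Data.List.Relation.Unary.AllPairs as AllPairs using (AllPairs; []; _∷_)
open import Data.List.Relation.Unary.AllPairs.Properties as AllPairs using ()
open import Data.List.Relation.Unary.Any using (here; there)
open import Data.List.Relation.Unary.Linked using (Linked)
open import Data.List.Relation.Unary.Linked.Properties
  using (AllPairs⇒Linked; Linked⇒AllPairs)
open import Data.List.Relation.Unary.Unique.Propositional using (Unique)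
open import Data.List.Relation.Unary.Unique.Propositional.Properties as Unique using ()
open import Data.Nat.Base
open import Data.Nat.Divisibility using (_∣_; _∤_; _∣?_; divides; ∣m∣n⇒∣m+n; ∣m⇒∣m*n; ∣-refl)
open import Data.Nat.DivMod using (_/_; m/n*n≤m; m*n/n≡m; /-monoˡ-≤)
open import Data.Nat.Properties
open import Data.Nat.Tactic.RingSolver using (solve-∀)
open import Data.Product.Base using (_×_; _,_; proj₁; proj₂; ∃₂)
open import Function.Base using (_∘_)
open import Function.Bundles using (_⇔_; mk⇔; module Equivalence)
open import Relation.Binary.PropositionalEquality
open import Relation.Nullary using (yes; no; ¬_; ¬?)
open import Relation.Unary using (Decidable)

import Data.List.Relation.Unary.Unique.DecPropositional _≟_ as DecUnique

record _PartitionOf_ (ps : List ℕ) (n : ℕ) : Set where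
  constructor partition
  field
    weaklyDecreasing : Linked _≥_ ps
    positive         : All (0 <_) ps
    total            : sum ps ≡ n

Odd : ℕ → Set
Odd m = 2 ∤ m

odd? : Decidable Odd
odd? m = ¬? (2 ∣? m)

OddPartsDistinct : List ℕ → Set
OddPartsDistinct ps = Unique (filter odd? ps)

oddPartsDistinct? : Decidable OddPartsDistinct
oddPartsDistinct? ps = DecUnique.unique? (filter odd? ps)

-- The partitions of n with all parts ≤ m, where k is the multiplicity of the
-- largest allowed part.
partitions≤ : (m n : ℕ) → List (List ℕ)
partitions≤ zero    zero    = [] ∷ []
partitions≤ zero    (suc n) = []
partitions≤ (suc m) n       =
  concatMap (λ k → map (replicate k (suc m) ++_) (partitions≤ m (n ∸ k * suc m)))
            (upTo (suc (n / suc m)))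

partitions : ℕ → List (List ℕ)
partitions n = partitions≤ n n

podPartitions : ℕ → List (List ℕ)
podPartitions n = filter oddPartsDistinct? (partitions n)

pod : ℕ → ℕ
pod n = length (podPartitions n)

-- The enumeration is correct: podPartitions n lists exactly the partitions of n
-- with distinct odd parts (∈-podPartitions), each once (podPartitions-unique).

private

  Bounded : ℕ → List ℕ → Set
  Bounded m ps = AllPairs _≥_ ps × All (0 <_) ps × All (_≤ m) ps

  sum-replicate-++ : ∀ k a qs → sum (replicate k a ++ qs) ≡ k * a + sum qs
  sum-replicate-++ zero    a qs = refl
  sum-replicate-++ (suc k) a qs =
    trans (cong (a +_) (sum-replicate-++ k a qs)) (sym (+-assoc a (k * a) (sum qs)))

  weaken : ∀ {m ps} → Bounded m ps → Bounded (suc m) ps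
  weaken (d , p , b) = d , p , All.map m≤n⇒m≤1+n b

  prepend : ∀ {m qs} k → Bounded (suc m) qs → Bounded (suc m) (replicate k (suc m) ++ qs)
  prepend zero    h = h
  prepend (suc k) h with prepend k h
  ... | d , p , b = (b ∷ d) , (z<s ∷ p) , (≤-refl ∷ b)

  split : ∀ {m} ps → Bounded (suc m) ps →
          ∃₂ λ k qs → ps ≡ replicate k (suc m) ++ qs × Bounded m qs
  split []       _ = 0 , [] , refl , [] , [] , []
  split {m} (x ∷ ps) (x≥ ∷ d , 0<x ∷ p , x≤ ∷ b) with x ≟ suc m
  ... | no x≢ = 0 , x ∷ ps , refl , (x≥ ∷ d) , (0<x ∷ p) , (x≤m ∷ All.map (λ y≤x → ≤-trans y≤x x≤m) x≥)
    where x≤m = s≤s⁻¹ (≤∧≢⇒< x≤ x≢)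
  ... | yes refl with split ps (d , p , b)
  ...   | k , qs , refl , h = suc k , qs , refl , h

  sound : ∀ m n {ps} → ps ∈ partitions≤ m n → Bounded m ps × sum ps ≡ n
  sound zero zero (here refl) = ([] , [] , []) , refl
  sound (suc m) n ps∈ with find (∈-concatMap⁻ _ {xs = upTo (suc (n / suc m))} ps∈)
  ... | k , k∈ , ps∈′ with ∈-map⁻ _ ps∈′
  ...   | qs , qs∈ , refl with sound m (n ∸ k * suc m) qs∈
  ...     | h , eq = prepend k (weaken h) , (begin
    sum (replicate k (suc m) ++ qs)   ≡⟨ sum-replicate-++ k (suc m) qs ⟩
    k * suc m + sum qs                ≡⟨ cong (k * suc m +_) eq ⟩
    k * suc m + (n ∸ k * suc m)       ≡⟨ m+[n∸m]≡n k*≤n ⟩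
    n                                 ∎)
    where
    open ≡-Reasoning
    k*≤n : k * suc m ≤ n
    k*≤n = ≤-trans (*-monoˡ-≤ (suc m) (s≤s⁻¹ (∈-upTo⁻ k∈))) (m/n*n≤m n (suc m))

  complete : ∀ m n {ps} → Bounded m ps → sum ps ≡ n → ps ∈ partitions≤ m n
  complete zero    .0 {[]}     _ refl = here refl
  complete zero    n {x ∷ ps} (_ , 0<x ∷ _ , x≤0 ∷ _) _ = ⊥-elim (<⇒≱ 0<x x≤0)
  complete (suc m) n {ps} h eq with split ps h
  ... | k , qs , refl , h′ =
    ∈-concatMap⁺ _ (lose (∈-upTo⁺ (s≤s k≤)) (∈-map⁺ _ (complete m _ h′ rest)))
    where
    total′ : k * suc m + sum qs ≡ n
    total′ = trans (sym (sum-replicate-++ k (suc m) qs)) eq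
    rest : sum qs ≡ n ∸ k * suc m
    rest = trans (sym (m+n∸m≡n (k * suc m) (sum qs))) (cong (_∸ k * suc m) total′)
    k≤ : k ≤ n / suc m
    k≤ = subst (_≤ n / suc m) (m*n/n≡m k (suc m))
           (/-monoˡ-≤ (suc m) (≤-trans (m≤m+n (k * suc m) (sum qs)) (≤-reflexive total′)))

  multiplicity-unique : ∀ {m qs qs′} k k′ → All (_≤ m) qs → All (_≤ m) qs′ →
                        replicate k (suc m) ++ qs ≡ replicate k′ (suc m) ++ qs′ → k ≡ k′
  multiplicity-unique zero    zero     _ _ _ = refl
  multiplicity-unique zero    (suc k′) (b ∷ _) _ refl = ⊥-elim (1+n≰n b)
  multiplicity-unique (suc k) zero     _ (b ∷ _) refl = ⊥-elim (1+n≰n b)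
  multiplicity-unique (suc k) (suc k′) b b′ eq =
    cong suc (multiplicity-unique k k′ b b′ (∷-injectiveʳ eq))

  unique : ∀ m n → Unique (partitions≤ m n)
  unique zero zero    = [] ∷ []
  unique zero (suc n) = []
  unique (suc m) n = Unique.concat⁺
    (All.map⁺ (All.universal
      (λ k → Unique.map⁺ (++-cancelˡ (replicate k (suc m)) _ _) (unique m (n ∸ k * suc m))) _))
    (AllPairs.map⁺ (AllPairs.map disjoint (Unique.upTo⁺ (suc (n / suc m)))))
    where
    disjoint : ∀ {k k′} → k ≢ k′ → ∀ {ps} →
               ¬ (ps ∈ map (replicate k (suc m) ++_) (partitions≤ m (n ∸ k * suc m)) ×
                  ps ∈ map (replicate k′ (suc m) ++_) (partitions≤ m (n ∸ k′ * suc m)))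
    disjoint {k} {k′} k≢k′ (ps∈ , ps∈′) with ∈-map⁻ _ ps∈ | ∈-map⁻ _ ps∈′
    ... | qs , qs∈ , refl | qs′ , qs′∈ , eq =
      k≢k′ (multiplicity-unique k k′ (bounded qs∈) (bounded qs′∈) eq)
      where
      bounded : ∀ {l rs} → rs ∈ partitions≤ m l → All (_≤ m) rs
      bounded rs∈ = proj₂ (proj₂ (proj₁ (sound m _ rs∈)))

  parts≤sum : ∀ ps → All (_≤ sum ps) ps
  parts≤sum []       = []
  parts≤sum (x ∷ ps) =
    m≤m+n x (sum ps) ∷ All.map (λ y≤ → ≤-trans y≤ (m≤n+m (sum ps) x)) (parts≤sum ps)

∈-partitions : ∀ {n ps} → ps ∈ partitions n ⇔ ps PartitionOf n
∈-partitions {n} {ps} = mk⇔ to from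
  where
  to : ps ∈ partitions n → ps PartitionOf n
  to ps∈ with sound n n ps∈
  ... | (d , p , _) , eq = partition (AllPairs⇒Linked d) p eq
  from : ps PartitionOf n → ps ∈ partitions n
  from (partition d p refl) =
    complete n n (Linked⇒AllPairs (λ x≥y y≥z → ≤-trans y≥z x≥y) d , p , parts≤sum ps) refl

∈-podPartitions : ∀ {n ps} → ps ∈ podPartitions n ⇔ (ps PartitionOf n × OddPartsDistinct ps)
∈-podPartitions {n} {ps} = mk⇔ to from
  where
  open Equivalence (∈-partitions {n} {ps}) renaming (to to to′; from to from′)
  to : ps ∈ podPartitions n → ps PartitionOf n × OddPartsDistinct ps
  to ps∈ with ∈-filter⁻ oddPartsDistinct? {xs = partitions n} ps∈
  ... | ps∈′ , dist = to′ ps∈′ , dist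
  from : ps PartitionOf n × OddPartsDistinct ps → ps ∈ podPartitions n
  from (h , dist) = ∈-filter⁺ oddPartsDistinct? (from′ h) dist

podPartitions-unique : ∀ n → Unique (podPartitions n)
podPartitions-unique n = Unique.filter⁺ oddPartsDistinct? (unique n n)

-- The divisions by 8 in the arguments of pod are exact.

private
  8∣step : ∀ c → 8 ∣ c * 5 + 1 → ∀ α → 8 ∣ c * 5 ^ (2 * α + 1) + 1
  8∣step c h zero = h
  8∣step c h (suc α) =
    subst (8 ∣_) (sym eq) (∣m∣n⇒∣m+n (8∣step c h α) (∣m⇒∣m*n (3 * (c * x)) ∣-refl))
    where
    x = 5 ^ (2 * α + 1)
    ring : ∀ c x → c * (5 * (5 * x)) + 1 ≡ c * x + 1 + 8 * (3 * (c * x))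
    ring = solve-∀
    eq : c * 5 ^ (2 * suc α + 1) + 1 ≡ c * x + 1 + 8 * (3 * (c * x))
    eq = trans (cong (λ e → c * 5 ^ (e + 1) + 1) (*-suc 2 α)) (ring c x)

8∣11*5^[2α+1]+1 : ∀ α → 8 ∣ 11 * 5 ^ (2 * α + 1) + 1
8∣11*5^[2α+1]+1 = 8∣step 11 (divides 7 refl)

8∣19*5^[2α+1]+1 : ∀ α → 8 ∣ 19 * 5 ^ (2 * α + 1) + 1
8∣19*5^[2α+1]+1 = 8∣step 19 (divides 12 refl)

_ : map pod (upTo 12) ≡ 1 ∷ 1 ∷ 1 ∷ 2 ∷ 3 ∷ 4 ∷ 5 ∷ 7 ∷ 10 ∷ 13 ∷ 16 ∷ 21 ∷ []
_ = refl

{-# OPTIONS --safe #-}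
module Submission where

-- Write P = ∑ (-1)ⁿ pod(n) qⁿ and ψ = ∑ q^(j(j+1)/2). Gauss' identity, in Shanks' finite form,
-- gives ψ P = 1. Modulo 5 we have ψ⁵ = ψ(q⁵), so ψ(q⁵) P = ψ⁴. The coefficient of qⁿ in ψᵈ counts,
-- up to the factor 2ᵈ, the representations of 8n + d as a sum of d odd squares. For d = 4, left
-- multiplication by the six integral quaternions 1 ± 2i, 1 ± 2j, 1 ± 2k of norm 5 shows that the
-- coefficients of ψ⁴ at 5n + 2 and n agree modulo 5; extracting the exponents 5n + 2 therefore turns
-- ψ(q⁵) P = ψ⁴ into (∑ ± pod(5n + 2) qⁿ) ψ = ψ⁴, that is, ± pod(5n + 2) is the coefficient of qⁿ in
-- ψ³. For d = 3, conjugation by the same six quaternions is the Hecke operator at 5 on sums of three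
-- squares: with N = 8n + 3, the number of representations of 25N is divisible by 5 if N ≡ ±1 mod 5,
-- and is congruent to that of N if 5 divides N.

open import Algebra.Bundles using (AbelianGroup; CommutativeRing)
open import Algebra.Solver.Ring.AlmostCommutativeRing using (fromCommutativeRing; _-Raw-AlmostCommutative⟶_)
import Algebra.Solver.Ring
open import Data.Integer.Base as ℤ using (ℤ; +_; -[1+_])
open import Data.Integer.DivMod using (_%ℕ_; _/ℕ_; a≡a%ℕn+[a/ℕn]*n; n%ℕd<d)
import Data.Integer.Properties as ℤ
import Data.Integer.Tactic.RingSolver as ℤ-Solver
open import Data.List.Base as List
  using (List; []; _∷_; _++_; _∷ʳ_; applyUpTo; cartesianProductWith; concatMap; filter; length; replicate; upTo)
open import Data.List.Membership.Propositional using (_∈_; find)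
open import Data.List.Membership.Propositional.Properties
  using (∈-++⁺ˡ; ∈-++⁺ʳ; ∈-cartesianProductWith⁺; ∈-concatMap⁻; ∈-filter⁺; ∈-filter⁻; ∈-map⁺; ∈-map⁻; ∈-upTo⁺)
open import Data.List.Membership.Propositional.Properties.WithK using (unique∧set⇒bag)
open import Data.List.Properties
  using (filter-++; filter-accept; filter-reject; length-++; length-map; map-++; map-upTo; upTo-∷ʳ)
open import Data.List.Relation.Binary.BagAndSetEquality using (∼bag⇒↭)
open import Data.List.Relation.Binary.Permutation.Propositional.Properties using (↭-length)
import Data.List.Relation.Unary.All as ListAll

open import Data.List.Relation.Unary.AllPairs using ([]; _∷_)
open import Data.List.Relation.Unary.Any using (here; there)
open import Data.List.Relation.Unary.Unique.Propositional using (Unique)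
import Data.List.Relation.Unary.Unique.Propositional.Properties as Unique
open import Data.Maybe.Base using (Maybe; just; nothing)
open import Data.Nat.Base as ℕ using (ℕ; zero; suc; s≤s; s<s; z≤n; z<s)
open import Data.Nat.DivMod using (m*n/n≡m; m/n≡1+[m∸n]/n; m<n⇒m/n≡0; m≡m%n+[m/n]*n)
open import Data.Nat.ListAction using (sum)
import Data.Nat.Divisibility as ℕ
import Data.Nat.Properties as ℕ
import Data.Nat.Tactic.RingSolver as ℕ-Solver
open import Data.Product.Base using (_,_; _×_; ∃; proj₂)
open import Data.Sum.Base using (_⊎_; inj₁; inj₂)
open import Data.Vec.Base as Vec using (Vec; []; _∷_)
open import Data.Vec.Properties using (∷-injective; ∷-injectiveˡ; ∷-injectiveʳ)

open import Function.Base using (_∘_)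
open import Function.Bundles using (_⇔_; mk⇔; module Equivalence)
open import Relation.Binary.PropositionalEquality
  using (_≡_; _≢_; refl; sym; trans; cong; cong₂; subst; module ≡-Reasoning)
import Relation.Binary.Reasoning.Setoid as ≈-Reasoning
open import Relation.Nullary using (¬_; yes; no; contradiction; _→-dec_; _⊎-dec_)
open import Relation.Nullary.Decidable using (toWitness)
open import Relation.Unary using (Pred; Decidable)

-- The Hecke relations come from counting pairs (R, b), where b represents the larger number and
-- lies in the image of the quaternionic map R. Each R contributes the number of representations of
-- the smaller number. Modulo 5 only the number of R per b matters, and this depends on a residue
-- vector of b alone, so a finite check replaces both unique factorization of quaternions and
-- modular forms. The obstacle is in dimension 3, at vectors b = 5u, where norm u = N. Such a b lies
-- in 2 images if N ≡ ±1 mod 5, in none if N ≡ ±2, and in 1 or 6 if 5 divides N, whereas every other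
-- b lies in exactly one. For N ≡ ±1, adjoining four copies of multiplication by 5 raises 2 to 6,
-- and raises the number of maps from 6 to 10; this 10 is the source of the vanishing. The constants
-- are 11 = 8·1 + 3 and 19 = 8·2 + 3, so N = 40n + 11 or 40n + 19 is ±1 modulo 5. One factor 25
-- produces the zero, and every further factor preserves it, because the number is by now divisible
-- by 5.

-- Formal power series over a commutative ring

module PowerSeries {c ℓ} (K : CommutativeRing c ℓ) where
  private module K = CommutativeRing K
  open K using (Carrier)
  open import Algebra.Properties.CommutativeSemigroup K.+-commutativeSemigroup using (interchange; x∙yz≈y∙xz)
  open import Relation.Binary.Reasoning.Setoid K.setoid

  Series : Set c
  Series = ℕ → Carrier

  infix 4 _≈_
  record _≈_ (f g : Series) : Set ℓ where
    constructor coeffwise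
    field coeff : ∀ n → f n K.≈ g n
  open _≈_ public

  infixl 6 _+_
  infixl 7 _*_ _·_
  infix 8 -_

  _+_ : Series → Series → Series
  (f + g) n = f n K.+ g n

  -_ : Series → Series
  (- f) n = K.- f n

  _·_ : Carrier → Series → Series
  (a · f) n = a K.* f n

  -- Splitting the left factor as f = f 0 + q (f ∘ suc) avoids finite sums. The price is asymmetry:
  -- commutativity needs the mirrored recursion `*-suc-coeff`.
  _*_ : Series → Series → Series
  (f * g) zero    = f 0 K.* g 0
  (f * g) (suc n) = f 0 K.* g (suc n) K.+ (f ∘ suc * g) n

  const : Carrier → Series
  const a zero    = a
  const a (suc n) = K.0#

  0# 1# : Series
  0# n = K.0#
  1# = const K.1#

  -- This replaces limits: at a given coefficient, infinite series may be exchanged for truncations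
  -- that agree far enough.
  *-local : ∀ {f f′ g g′} n → (∀ {i} → i ℕ.≤ n → f i K.≈ f′ i) → (∀ {i} → i ℕ.≤ n → g i K.≈ g′ i) →
            (f * g) n K.≈ (f′ * g′) n
  *-local zero    f≈ g≈ = K.*-cong (f≈ z≤n) (g≈ z≤n)
  *-local (suc n) f≈ g≈ = K.+-cong (K.*-cong (f≈ z≤n) (g≈ ℕ.≤-refl))
    (*-local n (f≈ ∘ s≤s) (g≈ ∘ ℕ.m≤n⇒m≤1+n))

  *-cong-coeff : ∀ {f f′ g g′} → (∀ n → f n K.≈ f′ n) → (∀ n → g n K.≈ g′ n) → ∀ n → (f * g) n K.≈ (f′ * g′) n
  *-cong-coeff f≈ g≈ n = *-local n (λ {i} _ → f≈ i) (λ {i} _ → g≈ i)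

  zeroˡ-coeff : ∀ g n → (0# * g) n K.≈ K.0#
  zeroˡ-coeff g zero    = K.zeroˡ _
  zeroˡ-coeff g (suc n) = K.trans (K.+-cong (K.zeroˡ _) (zeroˡ-coeff g n)) (K.+-identityˡ _)

  const-*-coeff : ∀ a g n → (const a * g) n K.≈ a K.* g n
  const-*-coeff a g zero    = K.refl
  const-*-coeff a g (suc n) = K.trans (K.+-congˡ (zeroˡ-coeff g n)) (K.+-identityʳ _)

  distribʳ-coeff : ∀ f g h n → ((g + h) * f) n K.≈ (g * f) n K.+ (h * f) n
  distribʳ-coeff f g h zero    = K.distribʳ _ _ _
  distribʳ-coeff f g h (suc n) = K.trans
    (K.+-cong (K.distribʳ _ _ _) (distribʳ-coeff f (g ∘ suc) (h ∘ suc) n)) (interchange _ _ _ _)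

  ·-*-coeff : ∀ a f g n → ((a · f) * g) n K.≈ a K.* (f * g) n
  ·-*-coeff a f g zero    = K.*-assoc _ _ _
  ·-*-coeff a f g (suc n) = K.trans
    (K.+-cong (K.*-assoc _ _ _) (·-*-coeff a (f ∘ suc) g n)) (K.sym (K.distribˡ _ _ _))

  *-suc-coeff : ∀ f g n → (f * g) (suc n) K.≈ f (suc n) K.* g 0 K.+ (f * g ∘ suc) n
  *-suc-coeff f g zero    = K.+-comm _ _
  *-suc-coeff f g (suc n) = K.trans (K.+-congˡ (*-suc-coeff (f ∘ suc) g n)) (x∙yz≈y∙xz _ _ _)

  *-comm-coeff : ∀ f g n → (f * g) n K.≈ (g * f) n
  *-comm-coeff f g zero    = K.*-comm _ _
  *-comm-coeff f g (suc n) = K.trans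
    (K.+-cong (K.*-comm _ _) (*-comm-coeff (f ∘ suc) g n)) (K.sym (*-suc-coeff g f n))

  *-assoc-coeff : ∀ f g h n → ((f * g) * h) n K.≈ (f * (g * h)) n
  *-assoc-coeff f g h zero    = K.*-assoc _ _ _
  *-assoc-coeff f g h (suc n) = begin
    f 0 K.* g 0 K.* h (suc n) K.+ ((f 0 · (g ∘ suc) + f ∘ suc * g) * h) n
      ≈⟨ K.+-cong (K.*-assoc _ _ _) (distribʳ-coeff h _ _ n) ⟩
    f 0 K.* (g 0 K.* h (suc n)) K.+ (((f 0 · (g ∘ suc)) * h) n K.+ ((f ∘ suc * g) * h) n)
      ≈⟨ K.+-congˡ (K.+-cong (·-*-coeff (f 0) (g ∘ suc) h n) (*-assoc-coeff (f ∘ suc) g h n)) ⟩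
    f 0 K.* (g 0 K.* h (suc n)) K.+ (f 0 K.* (g ∘ suc * h) n K.+ (f ∘ suc * (g * h)) n)
      ≈⟨ K.+-assoc _ _ _ ⟨
    f 0 K.* (g 0 K.* h (suc n)) K.+ f 0 K.* (g ∘ suc * h) n K.+ (f ∘ suc * (g * h)) n
      ≈⟨ K.+-congʳ (K.distribˡ _ _ _) ⟨
    f 0 K.* (g * h) (suc n) K.+ (f ∘ suc * (g * h)) n ∎

  1#-*-coeff : ∀ f n → (1# * f) n K.≈ f n
  1#-*-coeff f n = K.trans (const-*-coeff K.1# f n) (K.*-identityˡ _)

  ring : CommutativeRing c ℓ
  ring = record
    { Carrier = Series ; _≈_ = _≈_ ; _+_ = _+_ ; _*_ = _*_ ; -_ = -_ ; 0# = 0# ; 1# = 1#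
    ; isCommutativeRing = record
      { isRing = record
        { +-isAbelianGroup = record
          { isGroup = record
            { isMonoid = record
              { isSemigroup = record
                { isMagma = record
                  { isEquivalence = record
                    { refl  = coeffwise λ _ → K.refl
                    ; sym   = λ p → coeffwise λ n → K.sym (coeff p n)
                    ; trans = λ p r → coeffwise λ n → K.trans (coeff p n) (coeff r n)
                    }
                  ; ∙-cong = λ p r → coeffwise λ n → K.+-cong (coeff p n) (coeff r n)
                  }
                ; assoc = λ f g h → coeffwise λ n → K.+-assoc _ _ _
                }
              ; identity = (λ f → coeffwise λ n → K.+-identityˡ _) , (λ f → coeffwise λ n → K.+-identityʳ _)
              }
            ; inverse = (λ f → coeffwise λ n → K.-‿inverseˡ _) , (λ f → coeffwise λ n → K.-‿inverseʳ _)
            ; ⁻¹-cong = λ p → coeffwise λ n → K.-‿cong (coeff p n)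
            }
          ; comm = λ f g → coeffwise λ n → K.+-comm _ _
          }
        ; *-cong = λ p r → coeffwise (*-cong-coeff (coeff p) (coeff r))
        ; *-assoc = λ f g h → coeffwise (*-assoc-coeff f g h)
        ; *-identity = (λ f → coeffwise (1#-*-coeff f))
                     , (λ f → coeffwise λ n → K.trans (*-comm-coeff f 1# n) (1#-*-coeff f n))
        ; distrib = (λ f g h → coeffwise λ n → K.trans (*-comm-coeff f (g + h) n)
                        (K.trans (distribʳ-coeff f g h n) (K.+-cong (*-comm-coeff g f n) (*-comm-coeff h f n))))
                  , (λ f g h → coeffwise (distribʳ-coeff f g h))
        }
      ; *-comm = λ f g → coeffwise (*-comm-coeff f g)
      }
    }

  q^_ : ℕ → Series
  (q^ zero)  = 1#
  (q^ suc m) zero    = K.0#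
  (q^ suc m) (suc n) = (q^ m) n

  private module S = CommutativeRing ring

  q^0-* : ∀ f → q^ 0 * f ≈ f
  q^0-* = S.*-identityˡ

  q^-*-suc : ∀ m f n → (q^ suc m * f) (suc n) K.≈ (q^ m * f) n
  q^-*-suc m f n = K.trans (K.+-congʳ (K.zeroˡ _)) (K.+-identityˡ _)

  q^-*-< : ∀ {m n} f → n ℕ.< m → (q^ m * f) n K.≈ K.0#
  q^-*-< {suc m} {zero}  f _       = K.zeroˡ _
  q^-*-< {suc m} {suc n} f (s<s n<m) = K.trans (q^-*-suc m f n) (q^-*-< f n<m)

  q^-*-+ : ∀ m f n → (q^ m * f) (m ℕ.+ n) K.≈ f n
  q^-*-+ zero    f n = coeff (q^0-* f) n
  q^-*-+ (suc m) f n = K.trans (q^-*-suc m f (m ℕ.+ n)) (q^-*-+ m f n)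

  q^-*-shift : ∀ k m f n → (q^ (k ℕ.+ m) * f) (k ℕ.+ n) K.≈ (q^ m * f) n
  q^-*-shift zero    m f n = K.refl
  q^-*-shift (suc k) m f n = K.trans (q^-*-suc (k ℕ.+ m) f (k ℕ.+ n)) (q^-*-shift k m f n)

  q^-< : ∀ {m n} → n ℕ.< m → (q^ m) n K.≈ K.0#
  q^-< {m} n<m = K.trans (K.sym (coeff (S.*-identityʳ (q^ m)) _)) (q^-*-< 1# n<m)

  q^-+ : ∀ m n → q^ (m ℕ.+ n) ≈ q^ m * q^ n
  q^-+ zero    n = S.sym (q^0-* (q^ n))
  q^-+ (suc m) n = coeffwise λ where
    zero    → K.sym (q^-*-< {suc m} (q^ n) z<s)
    (suc i) → K.trans (coeff (q^-+ m n) i) (K.sym (q^-*-suc m (q^ n) i))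

  private
    fixed⇒0-< : ∀ m h → h ≈ q^ suc m * h → ∀ N {n} → n ℕ.< N → h n K.≈ K.0#
    fixed⇒0-< m h h≈ (suc N) {zero}  _ = K.trans (coeff h≈ 0) (q^-*-< {suc m} h z<s)
    fixed⇒0-< m h h≈ (suc N) {suc n} (s<s n<N) = begin
      h (suc n)                ≈⟨ coeff h≈ (suc n) ⟩
      (q^ suc m * h) (suc n)   ≈⟨ q^-*-suc m h n ⟩
      (q^ m * h) n             ≈⟨ *-local {q^ m} {q^ m} {h} {0#} n (λ _ → K.refl)
                                    (λ i≤n → fixed⇒0-< m h h≈ N (ℕ.≤-<-trans i≤n n<N)) ⟩
      (q^ m * 0#) n            ≈⟨ coeff (S.zeroʳ (q^ m)) n ⟩
      K.0#                     ∎

  -- Iterating the hypothesis makes h divisible by every power of q^(m+1). Formally, each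
  -- coefficient of h is expressed through strictly earlier ones.
  fixed⇒0 : ∀ m h → h ≈ q^ suc m * h → h ≈ 0#
  fixed⇒0 m h h≈ = coeffwise λ n → fixed⇒0-< m h h≈ (suc n) ℕ.≤-refl

-- Integers and power series modulo 5

module CharacteristicFive where
  open ℤ-Solver using (solve-∀)

  infix 4 _≋_
  record _≋_ (a b : ℤ) : Set where
    constructor congruent
    field
      quotient : ℤ
      equality : a ≡ b ℤ.+ quotient ℤ.* + 5

  ≡⇒≋ : ∀ {a b} → a ≡ b → a ≋ b
  ≡⇒≋ {a} refl = congruent (+ 0) (sym (ℤ.+-identityʳ a))

  -- The carrier stays ℤ and only equality is coarsened. Integer counts are thus coefficients as
  -- they stand, and a proof of `≋ + 0` carries the quotient by 5.
  ℤ/5 : CommutativeRing _ _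
  ℤ/5 = record
    { Carrier = ℤ ; _≈_ = _≋_ ; _+_ = ℤ._+_ ; _*_ = ℤ._*_ ; -_ = ℤ.-_ ; 0# = + 0 ; 1# = + 1
    ; isCommutativeRing = record
      { isRing = record
        { +-isAbelianGroup = record
          { isGroup = record
            { isMonoid = record
              { isSemigroup = record
                { isMagma = record
                  { isEquivalence = record { refl = ≡⇒≋ refl ; sym = ≋-sym ; trans = ≋-trans }
                  ; ∙-cong = +-cong
                  }
                ; assoc = λ a b c → ≡⇒≋ (ℤ.+-assoc a b c)
                }
              ; identity = (λ a → ≡⇒≋ (ℤ.+-identityˡ a)) , (λ a → ≡⇒≋ (ℤ.+-identityʳ a))
              }
            ; inverse = (λ a → ≡⇒≋ (ℤ.+-inverseˡ a)) , (λ a → ≡⇒≋ (ℤ.+-inverseʳ a))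
            ; ⁻¹-cong = neg-cong
            }
          ; comm = λ a b → ≡⇒≋ (ℤ.+-comm a b)
          }
        ; *-cong = *-cong
        ; *-assoc = λ a b c → ≡⇒≋ (ℤ.*-assoc a b c)
        ; *-identity = (λ a → ≡⇒≋ (ℤ.*-identityˡ a)) , (λ a → ≡⇒≋ (ℤ.*-identityʳ a))
        ; distrib = (λ a b c → ≡⇒≋ (ℤ.*-distribˡ-+ a b c)) , (λ a b c → ≡⇒≋ (ℤ.*-distribʳ-+ a b c))
        }
      ; *-comm = λ a b → ≡⇒≋ (ℤ.*-comm a b)
      }
    }
    where
    ≋-sym : ∀ {a b} → a ≋ b → b ≋ a
    ≋-sym {b = b} (congruent s refl) = congruent (ℤ.- s) (lemma b s)
      where
      lemma : ∀ b s → b ≡ b ℤ.+ s ℤ.* + 5 ℤ.+ ℤ.- s ℤ.* + 5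
      lemma = solve-∀
    ≋-trans : ∀ {a b c} → a ≋ b → b ≋ c → a ≋ c
    ≋-trans {c = c} (congruent s refl) (congruent t refl) = congruent (s ℤ.+ t) (lemma c s t)
      where
      lemma : ∀ c s t → c ℤ.+ t ℤ.* + 5 ℤ.+ s ℤ.* + 5 ≡ c ℤ.+ (s ℤ.+ t) ℤ.* + 5
      lemma = solve-∀
    +-cong : ∀ {a b c d} → a ≋ b → c ≋ d → a ℤ.+ c ≋ b ℤ.+ d
    +-cong {b = b} {d = d} (congruent s refl) (congruent t refl) = congruent (s ℤ.+ t) (lemma b d s t)
      where
      lemma : ∀ b d s t → (b ℤ.+ s ℤ.* + 5) ℤ.+ (d ℤ.+ t ℤ.* + 5) ≡ b ℤ.+ d ℤ.+ (s ℤ.+ t) ℤ.* + 5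
      lemma = solve-∀
    *-cong : ∀ {a b c d} → a ≋ b → c ≋ d → a ℤ.* c ≋ b ℤ.* d
    *-cong {b = b} {d = d} (congruent s refl) (congruent t refl) =
      congruent (s ℤ.* d ℤ.+ t ℤ.* b ℤ.+ s ℤ.* t ℤ.* + 5) (lemma b d s t)
      where
      lemma : ∀ b d s t → (b ℤ.+ s ℤ.* + 5) ℤ.* (d ℤ.+ t ℤ.* + 5) ≡
                          b ℤ.* d ℤ.+ (s ℤ.* d ℤ.+ t ℤ.* b ℤ.+ s ℤ.* t ℤ.* + 5) ℤ.* + 5
      lemma = solve-∀
    neg-cong : ∀ {a b} → a ≋ b → ℤ.- a ≋ ℤ.- b
    neg-cong {b = b} (congruent s refl) = congruent (ℤ.- s) (lemma b s)
      where
      lemma : ∀ b s → ℤ.- (b ℤ.+ s ℤ.* + 5) ≡ ℤ.- b ℤ.+ ℤ.- s ℤ.* + 5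
      lemma = solve-∀

  module K = CommutativeRing ℤ/5
  open PowerSeries ℤ/5 public
  module S = CommutativeRing ring

  ≋-weaklyDec : ∀ a b → Maybe (a ≋ b)
  ≋-weaklyDec a b with (a ℤ.- b) %ℕ 5 | a≡a%ℕn+[a/ℕn]*n (a ℤ.- b) 5
  ... | zero  | eq = just (congruent q (trans (lemma a b) (cong (λ c → b ℤ.+ c) (trans eq (ℤ.+-identityˡ _)))))
    where
    q = (a ℤ.- b) /ℕ 5
    lemma : ∀ a b → a ≡ b ℤ.+ (a ℤ.- b)
    lemma = solve-∀
  ... | suc _ | _  = nothing

  constants : ℤ.+-*-rawRing -Raw-AlmostCommutative⟶ fromCommutativeRing ring
  constants = record
    { ⟦_⟧    = const
    ; +-homo = λ a b → coeffwise λ { zero → K.refl ; (suc n) → K.refl }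
    ; *-homo = λ a b → coeffwise λ { zero → K.refl
                                         ; (suc n) → K.sym (K.trans (const-*-coeff a (const b) (suc n)) (K.zeroʳ a)) }
    ; -‿homo = λ a → coeffwise λ { zero → K.refl ; (suc n) → K.refl }
    ; 0-homo = coeffwise λ { zero → K.refl ; (suc n) → K.refl }
    ; 1-homo = S.refl
    }

  const-weaklyDec : ∀ a b → Maybe (const a ≈ const b)
  const-weaklyDec a b with ≋-weaklyDec a b
  ... | just a≋b = just (coeffwise λ { zero → a≋b ; (suc n) → K.refl })
  ... | nothing  = nothing

  -- Coefficients are compared modulo 5, so that this solver proves ring identities of characteristic 5.
  module Solver₅ = Algebra.Solver.Ring ℤ.+-*-rawRing (fromCommutativeRing ring) constants const-weaklyDec

  open import Algebra.Properties.Semiring.Exp S.semiring public using (_^_; ^-congˡ)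

  -- The middle binomial coefficients 5, 10, 10, 5 vanish modulo 5.
  frobenius : ∀ f g → (f + g) ^ 5 ≈ f ^ 5 + g ^ 5
  frobenius = solve 2 (λ f g → (f :+ g) :^ 5 := f :^ 5 :+ g :^ 5) S.refl
    where open Solver₅

-- Triangular numbers and Shanks' finite form of Gauss' identity

module Triangular where
  open CharacteristicFive
  open import Algebra.Properties.CommutativeSemiring.Exp S.commutativeSemiring using (^-distrib-*)

  ∑< : ℕ → (ℕ → Series) → Series
  ∑< zero    f = 0#
  ∑< (suc n) f = ∑< n f + f n

  ∑<-cong : ∀ n {f g} → (∀ {i} → i ℕ.< n → f i ≈ g i) → ∑< n f ≈ ∑< n g
  ∑<-cong zero    f≈g = S.refl
  ∑<-cong (suc n) f≈g = S.+-cong (∑<-cong n λ i<n → f≈g (ℕ.m≤n⇒m≤1+n i<n)) (f≈g ℕ.≤-refl)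

  tri : ℕ → ℕ
  tri zero    = 0
  tri (suc j) = suc j ℕ.+ tri j

  tri-even : ∀ n → tri (n ℕ.* 2) ≡ n ℕ.* (1 ℕ.+ n ℕ.* 2)
  tri-even zero    = refl
  tri-even (suc n) = trans (cong (λ t → 2 ℕ.+ n ℕ.* 2 ℕ.+ (1 ℕ.+ n ℕ.* 2 ℕ.+ t)) (tri-even n)) (lemma n)
    where
    lemma : ∀ n → 2 ℕ.+ n ℕ.* 2 ℕ.+ (1 ℕ.+ n ℕ.* 2 ℕ.+ n ℕ.* (1 ℕ.+ n ℕ.* 2)) ≡ suc n ℕ.* (1 ℕ.+ suc n ℕ.* 2)
    lemma = ℕ-Solver.solve-∀

  n≤tri : ∀ n → n ℕ.≤ tri n
  n≤tri zero    = z≤n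
  n≤tri (suc n) = ℕ.m≤m+n (suc n) (tri n)

  ψ< : ℕ → Series
  ψ< n = ∑< n λ j → q^ tri j

  q^-cong : ∀ {m n} → m ≡ n → q^ m ≈ q^ n
  q^-cong refl = S.refl

  q^-^ : ∀ m n → (q^ m) ^ n ≈ q^ (n ℕ.* m)
  q^-^ m zero    = S.refl
  q^-^ m (suc n) = S.trans (S.*-congˡ (q^-^ m n)) (S.sym (q^-+ m (n ℕ.* m)))

  1−-cong : ∀ {f g} → f ≈ g → 1# + - f ≈ 1# + - g
  1−-cong f≈g = S.+-congˡ {1#} (S.-‿cong f≈g)

  -- The difference f - g is fixed by multiplication by q^(m+1), hence zero. This stands in for
  -- inverting 1 - q^(m+1).
  cancel-1-q^ : ∀ m f g → (1# + - (q^ suc m)) * f ≈ (1# + - (q^ suc m)) * g → f ≈ g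
  cancel-1-q^ m f g eq = begin
    f                       ≈⟨ solve 2 (λ f g → f := (f :+ :- g) :+ g) S.refl f g ⟩
    (f + - g) + g           ≈⟨ S.+-congʳ (fixed⇒0 m (f + - g) fixed) ⟩
    0# + g                  ≈⟨ S.+-identityˡ g ⟩
    g                       ∎
    where
    open Solver₅
    open ≈-Reasoning S.setoid
    Q = q^ suc m
    fixed : f + - g ≈ Q * (f + - g)
    fixed = begin
      f + - g
        ≈⟨ solve 3 (λ q f g → f :+ :- g := (con (+ 1) :+ :- q) :* f :+ (q :* f :+ :- g)) S.refl Q f g ⟩
      (1# + - Q) * f + (Q * f + - g)                ≈⟨ S.+-congʳ eq ⟩
      (1# + - Q) * g + (Q * f + - g)
        ≈⟨ solve 3 (λ q f g → (con (+ 1) :+ :- q) :* g :+ (q :* f :+ :- g) := q :* (f :+ :- g)) S.refl Q f g ⟩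
      Q * (f + - g)                                 ∎

  -- `G-step` describes G n as G 0 times the product of (1 - q^(2i-1))/(1 - q^(2i)) over 1 ≤ i ≤ n,
  -- without division. The instance used later is the signed series of partitions with parts at most
  -- 2n.
  module Shanks (G : ℕ → Series)
    (G-step : ∀ n → (1# + - (q^ (2 ℕ.+ n ℕ.* 2))) * G (suc n) ≈ (1# + - (q^ (1 ℕ.+ n ℕ.* 2))) * G n)
    where
    open Solver₅
    open ≈-Reasoning S.setoid

    q : Series
    q = q^ 1

    y : ℕ → Series
    y n = (q * q) ^ n

    q^2n : ∀ n → q^ (n ℕ.* 2) ≈ y n
    q^2n n = S.trans (S.sym (q^-^ 2 n)) (^-congˡ n (q^-+ 1 1))

    q^2n+1 : ∀ n → q^ (1 ℕ.+ n ℕ.* 2) ≈ q * y n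
    q^2n+1 n = S.trans (q^-+ 1 (n ℕ.* 2)) (S.*-congˡ (q^2n n))

    q^2n+2 : ∀ n → q^ (2 ℕ.+ n ℕ.* 2) ≈ q * y n * q
    q^2n+2 n = S.trans (q^-+ 1 (1 ℕ.+ n ℕ.* 2)) (S.trans (S.*-congˡ (q^2n+1 n)) (S.*-comm _ _))

    G-step′ : ∀ n → (1# + - (q * y n * q)) * G (suc n) ≈ (1# + - (q * y n)) * G n
    G-step′ n = begin
      (1# + - (q * y n * q)) * G (suc n)             ≈⟨ S.*-congʳ (1−-cong (q^2n+2 n)) ⟨
      (1# + - (q^ (2 ℕ.+ n ℕ.* 2))) * G (suc n)      ≈⟨ G-step n ⟩
      (1# + - (q^ (1 ℕ.+ n ℕ.* 2))) * G n            ≈⟨ S.*-congʳ (1−-cong (q^2n+1 n)) ⟩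
      (1# + - (q * y n)) * G n                       ∎

    -- Only x = q^(2n+1) is needed below, but the induction requires x to be independent of n.
    telescope : ∀ x n →
      (1# + - (x * q)) * ∑< (suc n) (λ s → x ^ s * y s * G s) ≈
      (1# + - x) * ∑< n (λ s → x ^ s * G s) + x ^ n * G n * (1# + - (x * (q * y n)))
    telescope x zero = begin
      (1# + - (x * q)) * (0# + 1# * 1# * G 0)   ≈⟨ S.*-congˡ (S.+-identityˡ _) ⟩
      (1# + - (x * q)) * (1# * 1# * G 0)
        ≈⟨ solve 3 (λ x q g → (con (+ 1) :+ :- (x :* q)) :* (con (+ 1) :* con (+ 1) :* g) :=
                              con (+ 1) :* g :* (con (+ 1) :+ :- (x :* (q :* con (+ 1))))) S.refl x q (G 0) ⟩
      1# * G 0 * (1# + - (x * (q * 1#)))        ≈⟨ S.+-identityˡ _ ⟨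
      0# + 1# * G 0 * (1# + - (x * (q * 1#)))   ≈⟨ S.+-congʳ (S.zeroʳ _) ⟨
      (1# + - x) * 0# + 1# * G 0 * (1# + - (x * (q * 1#)))   ∎
    telescope x (suc n) = begin
      (1# + - (x * q)) * (B + x * X * (q * q * Y) * G′)
        ≈⟨ S.distribˡ _ _ _ ⟩
      (1# + - (x * q)) * B + (1# + - (x * q)) * (x * X * (q * q * Y) * G′)
        ≈⟨ S.+-congʳ (telescope x n) ⟩
      (1# + - x) * A + X * G n * (1# + - (x * (q * Y))) + (1# + - (x * q)) * (x * X * (q * q * Y) * G′)
        ≈⟨ solve 7 (λ x q y X A g g′ →
             (con (+ 1) :+ :- x) :* A :+ X :* g :* (con (+ 1) :+ :- (x :* (q :* y)))
               :+ (con (+ 1) :+ :- (x :* q)) :* (x :* X :* (q :* q :* y) :* g′) :=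
             (con (+ 1) :+ :- x) :* (A :+ X :* g) :+ x :* X :* ((con (+ 1) :+ :- (q :* y)) :* g)
               :+ (con (+ 1) :+ :- (x :* q)) :* (x :* X :* (q :* q :* y) :* g′))
             S.refl x q Y X A (G n) G′ ⟩
      (1# + - x) * (A + X * G n) + x * X * ((1# + - (q * Y)) * G n) + (1# + - (x * q)) * (x * X * (q * q * Y) * G′)
        ≈⟨ S.+-congʳ (S.+-congˡ {(1# + - x) * (A + X * G n)} (S.*-congˡ {x * X} (G-step′ n))) ⟨
      (1# + - x) * (A + X * G n) + x * X * ((1# + - (q * Y * q)) * G′) + (1# + - (x * q)) * (x * X * (q * q * Y) * G′)
        ≈⟨ solve 7 (λ x q y X A g g′ →
             (con (+ 1) :+ :- x) :* (A :+ X :* g) :+ x :* X :* ((con (+ 1) :+ :- (q :* y :* q)) :* g′)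
               :+ (con (+ 1) :+ :- (x :* q)) :* (x :* X :* (q :* q :* y) :* g′) :=
             (con (+ 1) :+ :- x) :* (A :+ X :* g)
               :+ x :* X :* g′ :* (con (+ 1) :+ :- (x :* (q :* (q :* q :* y)))))
             S.refl x q Y X A (G n) G′ ⟩
      (1# + - x) * (A + X * G n) + x * X * G′ * (1# + - (x * (q * (q * q * Y)))) ∎
      where
      A  = ∑< n (λ s → x ^ s * G s)
      B  = ∑< (suc n) (λ s → x ^ s * y s * G s)
      X  = x ^ n
      Y  = y n
      G′ = G (suc n)

    -- Put x = q^(2n+1). The two new exponents tri (2n) = n(2n+1) and tri (2n+1) = (n+1)(2n+1)
    -- contribute xⁿ and xⁿ⁺¹. After multiplication by 1 - q^(2n+2) they leave the extra term xⁿ G n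
    -- (1 - x²), which is precisely the boundary term of `telescope` at this x. On the right, the
    -- factor `y s` moves x to x q² = q^(2n+3).
    gauss : ∀ n → ψ< (n ℕ.* 2) * G n ≈ ∑< n (λ s → (q * y n) ^ s * G s)
    gauss zero    = S.zeroˡ (G 0)
    gauss (suc n) = cancel-1-q^ (1 ℕ.+ n ℕ.* 2) _ _ (begin
      (1# + - (q^ (2 ℕ.+ n ℕ.* 2))) * (Ψ′ * G′)
        ≈⟨ S.*-congʳ (1−-cong (q^2n+2 n)) ⟩
      (1# + - (x * q)) * (Ψ′ * G′)
        ≈⟨ S.*-congˡ (S.*-congʳ (S.+-cong (S.+-congˡ {Ψ} q^tri-2n) q^tri-2n+1)) ⟩
      (1# + - (x * q)) * ((Ψ + X + x * X) * G′)
        ≈⟨ solve 5 (λ c Ψ x X g′ → c :* ((Ψ :+ X :+ x :* X) :* g′) := (Ψ :+ X :+ x :* X) :* (c :* g′))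
             S.refl (1# + - (x * q)) Ψ x X G′ ⟩
      (Ψ + X + x * X) * ((1# + - (x * q)) * G′)
        ≈⟨ S.*-congˡ (G-step′ n) ⟩
      (Ψ + X + x * X) * ((1# + - x) * G n)
        ≈⟨ solve 4 (λ Ψ x X g → (Ψ :+ X :+ x :* X) :* ((con (+ 1) :+ :- x) :* g) :=
                                (con (+ 1) :+ :- x) :* (Ψ :* g) :+ X :* g :* (con (+ 1) :+ :- (x :* x)))
             S.refl Ψ x X (G n) ⟩
      (1# + - x) * (Ψ * G n) + X * G n * (1# + - (x * x))
        ≈⟨ S.+-congʳ (S.*-congˡ (gauss n)) ⟩
      (1# + - x) * ∑< n (λ s → x ^ s * G s) + X * G n * (1# + - (x * x))
        ≈⟨ telescope x n ⟨
      (1# + - (x * q)) * ∑< (suc n) (λ s → x ^ s * y s * G s)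
        ≈⟨ S.*-congʳ (1−-cong (q^2n+2 n)) ⟨
      (1# + - (q^ (2 ℕ.+ n ℕ.* 2))) * ∑< (suc n) (λ s → x ^ s * y s * G s)
        ≈⟨ S.*-congˡ (∑<-cong (suc n) λ {s} _ → S.*-congʳ (power s)) ⟩
      (1# + - (q^ (2 ℕ.+ n ℕ.* 2))) * ∑< (suc n) (λ s → (q * y (suc n)) ^ s * G s) ∎)
      where
      x  = q * y n
      X  = x ^ n
      Ψ  = ψ< (n ℕ.* 2)
      Ψ′ = ψ< (suc n ℕ.* 2)
      G′ = G (suc n)
      q^tri-2n : q^ tri (n ℕ.* 2) ≈ X
      q^tri-2n = begin
        q^ tri (n ℕ.* 2)             ≈⟨ q^-cong (tri-even n) ⟩
        q^ (n ℕ.* (1 ℕ.+ n ℕ.* 2))   ≈⟨ q^-^ (1 ℕ.+ n ℕ.* 2) n ⟨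
        (q^ (1 ℕ.+ n ℕ.* 2)) ^ n     ≈⟨ ^-congˡ n (q^2n+1 n) ⟩
        x ^ n                        ∎
      q^tri-2n+1 : q^ tri (suc (n ℕ.* 2)) ≈ x * X
      q^tri-2n+1 = S.trans (q^-+ (1 ℕ.+ n ℕ.* 2) (tri (n ℕ.* 2))) (S.*-cong (q^2n+1 n) q^tri-2n)
      power : ∀ s → x ^ s * y s ≈ (q * y (suc n)) ^ s
      power s = S.trans (S.sym (^-distrib-* x (q * q) s))
        (^-congˡ s (solve 2 (λ q y → q :* y :* (q :* q) := q :* (q :* q :* y)) S.refl q (y n)))

-- Recurrences for pod in the largest allowed part

module PodRecurrences where
  open import Defs
  open import Data.Nat.Base
  open import Data.Nat.Properties
  open import Data.Nat.Divisibility using (_∣_; _∤_)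
  open import Data.List.Base using (map)
  open import Data.List.Relation.Unary.All as All using (All; []; _∷_)
  import Data.List.Relation.Unary.All.Properties as All

  length-filter-cong : ∀ {a p q} {A : Set a} {P : Pred A p} {Q : Pred A q}
    (P? : Decidable P) (Q? : Decidable Q) (xs : List A) → (∀ {x} → x ∈ xs → P x ⇔ Q x) →
    length (filter P? xs) ≡ length (filter Q? xs)
  length-filter-cong P? Q? []       P⇔Q = refl
  length-filter-cong P? Q? (x ∷ xs) P⇔Q with P? x | Q? x
  ... | yes p | yes q = cong suc (length-filter-cong P? Q? xs (P⇔Q ∘ there))
  ... | no ¬p | no ¬q = length-filter-cong P? Q? xs (P⇔Q ∘ there)
  ... | yes p | no ¬q = contradiction (Equivalence.to (P⇔Q (here refl)) p) ¬q
  ... | no ¬p | yes q = contradiction (Equivalence.from (P⇔Q (here refl)) q) ¬p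

  length-filter-map : ∀ {a b p} {A : Set a} {B : Set b} {P : Pred B p} (P? : Decidable P) (f : A → B) xs →
    length (filter P? (map f xs)) ≡ length (filter (P? ∘ f) xs)
  length-filter-map P? f []       = refl
  length-filter-map P? f (x ∷ xs) with P? (f x)
  ... | yes _ = cong suc (length-filter-map P? f xs)
  ... | no  _ = length-filter-map P? f xs

  length-filter-concatMap : ∀ {a b p} {A : Set a} {B : Set b} {P : Pred B p} (P? : Decidable P)
    (f : A → List B) xs → length (filter P? (concatMap f xs)) ≡ sum (map (λ x → length (filter P? (f x))) xs)
  length-filter-concatMap P? f []       = refl
  length-filter-concatMap P? f (x ∷ xs) = begin
    length (filter P? (f x ++ concatMap f xs))                     ≡⟨ cong length (filter-++ P? (f x) _) ⟩
    length (filter P? (f x) ++ filter P? (concatMap f xs))         ≡⟨ length-++ (filter P? (f x)) ⟩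
    length (filter P? (f x)) + length (filter P? (concatMap f xs))
      ≡⟨ cong (λ l → length (filter P? (f x)) + l) (length-filter-concatMap P? f xs) ⟩
    _ ∎
    where open ≡-Reasoning

  pod≤ : ℕ → ℕ → ℕ
  pod≤ m n = length (filter oddPartsDistinct? (partitions≤ m n))

  partitions≤-bounded : ∀ m n {ps} → ps ∈ partitions≤ m n → All (_≤ m) ps
  partitions≤-bounded zero    zero    (here refl) = []
  partitions≤-bounded (suc m) n ps∈ with find (∈-concatMap⁻ _ {xs = upTo (suc (n / suc m))} ps∈)
  ... | k , _ , ps∈′ with ∈-map⁻ _ ps∈′
  ...   | qs , qs∈ , refl = All.++⁺ (All.replicate⁺ k ≤-refl)
    (All.map m≤n⇒m≤1+n (partitions≤-bounded m (n ∸ k * suc m) qs∈))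

  -- The number of partitions counted by pod≤ (suc m) n in which suc m occurs k times.
  multiplicityCount : ℕ → ℕ → ℕ → ℕ
  multiplicityCount m n k =
    length (filter (oddPartsDistinct? ∘ (replicate k (suc m) ++_)) (partitions≤ m (n ∸ k * suc m)))

  sum-applyUpTo-cong : ∀ {f g} n → (∀ k → f k ≡ g k) → sum (applyUpTo f n) ≡ sum (applyUpTo g n)
  sum-applyUpTo-cong zero    f≗g = refl
  sum-applyUpTo-cong (suc n) f≗g = cong₂ _+_ (f≗g 0) (sum-applyUpTo-cong n (f≗g ∘ suc))

  sum-applyUpTo-0 : ∀ n → sum (applyUpTo (λ _ → 0) n) ≡ 0
  sum-applyUpTo-0 zero    = refl
  sum-applyUpTo-0 (suc n) = sum-applyUpTo-0 n

  pod≤-suc : ∀ m n → pod≤ (suc m) n ≡ sum (applyUpTo (multiplicityCount m n) (suc (n / suc m)))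
  pod≤-suc m n = begin
    pod≤ (suc m) n
      ≡⟨ length-filter-concatMap oddPartsDistinct? withMultiplicity (upTo l) ⟩
    sum (map (length ∘ filter oddPartsDistinct? ∘ withMultiplicity) (upTo l))
      ≡⟨ cong sum (map-upTo (length ∘ filter oddPartsDistinct? ∘ withMultiplicity) l) ⟩
    sum (applyUpTo (length ∘ filter oddPartsDistinct? ∘ withMultiplicity) l)
      ≡⟨ sum-applyUpTo-cong l (λ k →
           length-filter-map oddPartsDistinct? (replicate k (suc m) ++_) (partitions≤ m (n ∸ k * suc m))) ⟩
    sum (applyUpTo (multiplicityCount m n) l)                   ∎
    where
    open ≡-Reasoning
    l = suc (n / suc m)
    withMultiplicity : ℕ → List (List ℕ)
    withMultiplicity k = map (replicate k (suc m) ++_) (partitions≤ m (n ∸ k * suc m))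

  pod≤-suc-< : ∀ {m n} → n < suc m → pod≤ (suc m) n ≡ pod≤ m n
  pod≤-suc-< {m} {n} n<1+m = begin
    pod≤ (suc m) n                                                   ≡⟨ pod≤-suc m n ⟩
    sum (applyUpTo (multiplicityCount m n) (suc (n / suc m)))
      ≡⟨ cong (λ d → sum (applyUpTo (multiplicityCount m n) (suc d))) (m<n⇒m/n≡0 n<1+m) ⟩
    multiplicityCount m n 0 + 0                                      ≡⟨ +-identityʳ _ ⟩
    pod≤ m n                                                         ∎
    where open ≡-Reasoning

  [m+n]/m : ∀ m n → (suc m + n) / suc m ≡ suc (n / suc m)
  [m+n]/m m n = trans (m/n≡1+[m∸n]/n (m≤m+n (suc m) n)) (cong (λ l → suc (l / suc m)) (m+n∸m≡n (suc m) n))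

  filter-odd-replicate : ∀ {d} k ps → 2 ∣ d → filter odd? (replicate k d ++ ps) ≡ filter odd? ps
  filter-odd-replicate zero    ps 2∣d = refl
  filter-odd-replicate {d} (suc k) ps 2∣d =
    trans (filter-reject odd? {d} {replicate k d ++ ps} (λ odd → odd 2∣d)) (filter-odd-replicate k ps 2∣d)

  -- Removing one copy of the even part `suc m` matches multiplicity k + 1 at suc m + n with
  -- multiplicity k at n, since the distinctness condition never sees even parts. For generating
  -- functions this is the factor 1/(1 - q^(m+1)).
  pod≤-even : ∀ m n → 2 ∣ suc m → pod≤ (suc m) (suc m + n) ≡ pod≤ m (suc m + n) + pod≤ (suc m) n
  pod≤-even m n 2∣1+m = begin
    pod≤ (suc m) (suc m + n)
      ≡⟨ pod≤-suc m (suc m + n) ⟩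
    sum (applyUpTo (multiplicityCount m (suc m + n)) (suc ((suc m + n) / suc m)))
      ≡⟨ cong (λ d → sum (applyUpTo (multiplicityCount m (suc m + n)) (suc d))) ([m+n]/m m n) ⟩
    pod≤ m (suc m + n) + sum (applyUpTo (multiplicityCount m (suc m + n) ∘ suc) (suc (n / suc m)))
      ≡⟨ cong (λ p → pod≤ m (suc m + n) + p) (sum-applyUpTo-cong (suc (n / suc m)) shift) ⟩
    pod≤ m (suc m + n) + sum (applyUpTo (multiplicityCount m n) (suc (n / suc m)))
      ≡⟨ cong (λ p → pod≤ m (suc m + n) + p) (pod≤-suc m n) ⟨
    pod≤ m (suc m + n) + pod≤ (suc m) n ∎
    where
    open ≡-Reasoning
    irrelevant : ∀ n k → multiplicityCount m n k ≡ pod≤ m (n ∸ k * suc m)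
    irrelevant n k = length-filter-cong _ oddPartsDistinct? (partitions≤ m (n ∸ k * suc m)) λ {ps} _ →
      let eq = filter-odd-replicate k ps 2∣1+m in mk⇔ (subst Unique eq) (subst Unique (sym eq))
    shift : ∀ k → multiplicityCount m (suc m + n) (suc k) ≡ multiplicityCount m n k
    shift k = begin
      multiplicityCount m (suc m + n) (suc k)         ≡⟨ irrelevant (suc m + n) (suc k) ⟩
      pod≤ m (suc m + n ∸ (suc m + k * suc m))        ≡⟨ cong (pod≤ m) ([m+n]∸[m+o]≡n∸o (suc m) n (k * suc m)) ⟩
      pod≤ m (n ∸ k * suc m)                          ≡⟨ irrelevant n k ⟨
      multiplicityCount m n k                         ∎

  -- Only the multiplicities 0 and 1 survive. One copy of `suc m` is always allowed because the
  -- remaining parts are at most m, and two copies violate distinctness. For generating functions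
  -- this is the factor 1 + q^(m+1).
  pod≤-odd : ∀ m n → 2 ∤ suc m → pod≤ (suc m) (suc m + n) ≡ pod≤ m (suc m + n) + pod≤ m n
  pod≤-odd m n 2∤1+m = begin
    pod≤ (suc m) (suc m + n)
      ≡⟨ pod≤-suc m (suc m + n) ⟩
    sum (applyUpTo (multiplicityCount m (suc m + n)) (suc ((suc m + n) / suc m)))
      ≡⟨ cong (λ d → sum (applyUpTo (multiplicityCount m (suc m + n)) (suc d))) ([m+n]/m m n) ⟩
    pod≤ m (suc m + n) + (multiplicityCount m (suc m + n) 1 +
      sum (applyUpTo (multiplicityCount m (suc m + n) ∘ suc ∘ suc) (n / suc m)))
      ≡⟨ cong (λ p → pod≤ m (suc m + n) + p) (cong₂ _+_ once
           (trans (sum-applyUpTo-cong (n / suc m) (repeated (suc m + n))) (sum-applyUpTo-0 (n / suc m)))) ⟩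
    pod≤ m (suc m + n) + (pod≤ m n + 0)
      ≡⟨ cong (λ p → pod≤ m (suc m + n) + p) (+-identityʳ _) ⟩
    pod≤ m (suc m + n) + pod≤ m n ∎
    where
    open ≡-Reasoning
    keep : ∀ ps → filter odd? (suc m ∷ ps) ≡ suc m ∷ filter odd? ps
    keep ps = filter-accept odd? 2∤1+m
    fresh : ∀ n {ps} → ps ∈ partitions≤ m n → OddPartsDistinct (suc m ∷ ps) ⇔ OddPartsDistinct ps
    fresh n {ps} ps∈ rewrite keep ps = mk⇔ (λ { (_ ∷ u) → u })
      (λ u → All.map (λ { p≤m refl → 1+n≰n p≤m }) (All.filter⁺ odd? (partitions≤-bounded m n ps∈)) ∷ u)
    twice : ∀ ps → ¬ OddPartsDistinct (suc m ∷ suc m ∷ ps)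
    twice ps rewrite keep (suc m ∷ ps) | keep ps = λ { ((≢ ∷ _) ∷ _) → ≢ refl }
    once : multiplicityCount m (suc m + n) 1 ≡ pod≤ m n
    once = trans
      (length-filter-cong _ oddPartsDistinct? (partitions≤ m (suc m + n ∸ 1 * suc m)) (fresh _))
      (cong (pod≤ m) (trans (cong (suc m + n ∸_) (*-identityˡ (suc m))) (m+n∸m≡n (suc m) n)))
    repeated : ∀ n k → multiplicityCount m n (suc (suc k)) ≡ 0
    repeated n k = none (partitions≤ m (n ∸ suc (suc k) * suc m))
      where
      none : ∀ pss → length (filter (oddPartsDistinct? ∘ (replicate (suc (suc k)) (suc m) ++_)) pss) ≡ 0
      none []         = refl
      none (ps ∷ pss) with oddPartsDistinct? (replicate (suc (suc k)) (suc m) ++ ps)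
      ... | yes d = contradiction d (twice (replicate k (suc m) ++ ps))
      ... | no  _ = none pss

  pod≤-stable : ∀ k n → pod≤ (k + n) n ≡ pod n
  pod≤-stable zero    n = refl
  pod≤-stable (suc k) n = trans (pod≤-suc-< (s≤s (m≤n+m n k))) (pod≤-stable k n)

-- The signed generating function of pod as the inverse of ψ

module SignedPod where
  open import Data.Nat.Divisibility using (_∣_; _∤_; divides; ∣m+n∣m⇒∣n; ∣1⇒≡1; n∣m*n)
  open import Defs using (pod)
  open CharacteristicFive
  open Triangular
  open PodRecurrences

  split-coeff : ∀ m {f g} → (∀ {n} → n ℕ.< m → f n ≋ g n) → (∀ n → f (m ℕ.+ n) ≋ g (m ℕ.+ n)) → f ≈ g
  split-coeff m {f} {g} f<g f≥g = coeffwise λ n → go n (ℕ.<-≤-connex n m)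
    where
    go : ∀ n → _ → f n ≋ g n
    go n (inj₁ n<m) = f<g n<m
    go n (inj₂ m≤n) = subst (λ i → f i ≋ g i) (ℕ.m+[n∸m]≡n m≤n) (f≥g (n ℕ.∸ m))

  sign : ℕ → ℤ
  sign zero    = + 1
  sign (suc n) = ℤ.- sign n

  sign-+ : ∀ m n → sign (m ℕ.+ n) ≡ sign m ℤ.* sign n
  sign-+ zero    n = sym (ℤ.*-identityˡ (sign n))
  sign-+ (suc m) n = trans (cong ℤ.-_ (sign-+ m n)) (ℤ.neg-distribˡ-* (sign m) (sign n))

  sign-2n : ∀ n → sign (n ℕ.* 2) ≡ + 1
  sign-2n zero    = refl
  sign-2n (suc n) = trans (ℤ.neg-involutive (sign (n ℕ.* 2))) (sign-2n n)

  -- Generating functions with q replaced by -q, which makes every sign in ψ positive.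
  signedPod≤ : ℕ → Series
  signedPod≤ m n = sign n ℤ.* + pod≤ m n

  signedPod : Series
  signedPod n = sign n ℤ.* + pod n

  1−q^-expand : ∀ m f → (1# + - (q^ m)) * f ≈ f + - (q^ m * f)
  1−q^-expand m f = solve 2 (λ q f → (con (+ 1) :+ :- q) :* f := f :+ :- (q :* f)) S.refl (q^ m) f
    where open Solver₅

  1−q^-*-< : ∀ {m n} f → n ℕ.< m → ((1# + - (q^ m)) * f) n ≋ f n
  1−q^-*-< {m} {n} f n<m = K.trans (coeff (1−q^-expand m f) n)
    (K.trans (K.+-congˡ {f n} (K.-‿cong (q^-*-< f n<m))) (K.+-identityʳ (f n)))

  1−q^-*-+ : ∀ m f n → ((1# + - (q^ m)) * f) (m ℕ.+ n) ≋ f (m ℕ.+ n) ℤ.- f n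
  1−q^-*-+ m f n = K.trans (coeff (1−q^-expand m f) (m ℕ.+ n)) (K.+-congˡ {f (m ℕ.+ n)} (K.-‿cong (q^-*-+ m f n)))

  signedPod≤-suc-< : ∀ {m n} → n ℕ.< suc m → signedPod≤ (suc m) n ≡ signedPod≤ m n
  signedPod≤-suc-< {n = n} n<1+m = cong (λ p → sign n ℤ.* + p) (pod≤-suc-< n<1+m)

  signedPod≤-even : ∀ n → (1# + - (q^ (2 ℕ.+ n ℕ.* 2))) * signedPod≤ (2 ℕ.+ n ℕ.* 2) ≈ signedPod≤ (1 ℕ.+ n ℕ.* 2)
  signedPod≤-even n = split-coeff M
    (λ {i} i<M → K.trans (1−q^-*-< F i<M) (≡⇒≋ (signedPod≤-suc-< i<M)))
    (λ i → K.trans (1−q^-*-+ M F i) (≡⇒≋ (above i)))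
    where
    M = 2 ℕ.+ n ℕ.* 2
    F = signedPod≤ M
    ring-eq : ∀ s a b → s ℤ.* (a ℤ.+ b) ℤ.- s ℤ.* b ≡ s ℤ.* a
    ring-eq = ℤ-Solver.solve-∀
    sign-M+ : ∀ i → sign (M ℕ.+ i) ≡ sign i
    sign-M+ i = trans (sign-+ M i) (trans (cong (ℤ._* sign i) (sign-2n (suc n))) (ℤ.*-identityˡ (sign i)))
    above : ∀ i → F (M ℕ.+ i) ℤ.- F i ≡ signedPod≤ (1 ℕ.+ n ℕ.* 2) (M ℕ.+ i)
    above i = trans
      (cong₂ (λ s p → s ℤ.* + p ℤ.- F i) (sign-M+ i) (pod≤-even (1 ℕ.+ n ℕ.* 2) i (divides (suc n) refl)))
      (trans (ring-eq (sign i) (+ a) (+ pod≤ M i)) (cong (ℤ._* + a) (sym (sign-M+ i))))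
      where a = pod≤ (1 ℕ.+ n ℕ.* 2) (M ℕ.+ i)

  -- A shift by an odd amount flips the sign, so 1 + q^(2n+1) becomes 1 - q^(2n+1), while the even
  -- factors keep their shape. Together they give the quotient that `Shanks` expects.
  signedPod≤-odd : ∀ n → signedPod≤ (1 ℕ.+ n ℕ.* 2) ≈ (1# + - (q^ (1 ℕ.+ n ℕ.* 2))) * signedPod≤ (n ℕ.* 2)
  signedPod≤-odd n = split-coeff M
    (λ {i} i<M → K.trans (≡⇒≋ (signedPod≤-suc-< i<M)) (K.sym (1−q^-*-< F i<M)))
    (λ i → K.trans (≡⇒≋ (above i)) (K.sym (1−q^-*-+ M F i)))
    where
    M = 1 ℕ.+ n ℕ.* 2
    F = signedPod≤ (n ℕ.* 2)
    ring-eq : ∀ s a b → ℤ.- s ℤ.* (a ℤ.+ b) ≡ ℤ.- s ℤ.* a ℤ.- s ℤ.* b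
    ring-eq = ℤ-Solver.solve-∀
    odd : 2 ∤ M
    odd 2∣M with ∣1⇒≡1 (∣m+n∣m⇒∣n (subst (2 ∣_) (ℕ.+-comm 1 (n ℕ.* 2)) 2∣M) (n∣m*n n))
    ... | ()
    sign-M+ : ∀ i → sign (M ℕ.+ i) ≡ ℤ.- sign i
    sign-M+ i = cong ℤ.-_ (trans (sign-+ (n ℕ.* 2) i) (trans (cong (ℤ._* sign i) (sign-2n n)) (ℤ.*-identityˡ (sign i))))
    above : ∀ i → signedPod≤ M (M ℕ.+ i) ≡ F (M ℕ.+ i) ℤ.- F i
    above i = trans
      (cong₂ (λ s p → s ℤ.* + p) (sign-M+ i) (pod≤-odd (n ℕ.* 2) i odd))
      (trans (ring-eq (sign i) (+ pod≤ (n ℕ.* 2) (M ℕ.+ i)) (+ pod≤ (n ℕ.* 2) i))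
             (cong (λ s → s ℤ.* + pod≤ (n ℕ.* 2) (M ℕ.+ i) ℤ.- F i) (sym (sign-M+ i))))

  open Shanks (λ n → signedPod≤ (n ℕ.* 2)) (λ n → S.trans (signedPod≤-even n) (signedPod≤-odd n))

  -- An infinite sum read along the diagonal: as tri j ≥ j, the terms with j > n do not reach the
  -- coefficient of qⁿ.
  ψ : Series
  ψ n = ψ< (suc n) n

  ψ<-stable : ∀ k n → ψ< (k ℕ.+ suc n) n ≋ ψ n
  ψ<-stable zero    n = K.refl
  ψ<-stable (suc k) n = K.trans (K.+-cong (ψ<-stable k n) (q^-< n<tri)) (K.+-identityʳ (ψ n))
    where
    n<tri : n ℕ.< tri (k ℕ.+ suc n)
    n<tri = ℕ.≤-trans (ℕ.m≤n+m (suc n) k) (n≤tri (k ℕ.+ suc n))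

  ψ<-≋-ψ : ∀ {N n} → n ℕ.< N → ψ< N n ≋ ψ n
  ψ<-≋-ψ {N} {n} n<N = subst (λ M → ψ< M n ≋ ψ n) (ℕ.m∸n+n≡m n<N) (ψ<-stable (N ℕ.∸ suc n) n)

  signedPod≤-≋-signedPod : ∀ {N n} → n ℕ.≤ N → signedPod≤ N n ≋ signedPod n
  signedPod≤-≋-signedPod {N} {n} n≤N = ≡⇒≋ (cong (λ p → sign n ℤ.* + p)
    (trans (cong (λ M → pod≤ M n) (sym (ℕ.m∸n+n≡m n≤N))) (pod≤-stable (N ℕ.∸ n) n)))

  ∑<-head : ∀ k f n → (∀ i → f (suc i) n ≋ + 0) → ∑< (suc k) f n ≋ f 0 n
  ∑<-head zero    f n f≋0 = K.+-identityˡ _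
  ∑<-head (suc k) f n f≋0 = K.trans (K.+-cong (∑<-head k f n f≋0) (f≋0 k)) (K.+-identityʳ _)

  -- In `gauss (suc n)` every term with s ≥ 1 is divisible by q^(2n+3) and is invisible at qⁿ. The
  -- term s = 0 is the series of the empty partition, and both factors on the left have already
  -- reached their limits at the coefficients involved.
  ψ*signedPod≈1 : ψ * signedPod ≈ 1#
  ψ*signedPod≈1 = coeffwise λ n → begin
    (ψ * signedPod) n
      ≈⟨ *-local n (λ i≤n → ψ<-≋-ψ (bound i≤n)) (λ i≤n → signedPod≤-≋-signedPod (ℕ.<⇒≤ (bound i≤n))) ⟨
    (ψ< (suc n ℕ.* 2) * signedPod≤ (suc n ℕ.* 2)) n
      ≈⟨ coeff (gauss (suc n)) n ⟩
    ∑< (suc n) (λ s → (q * y (suc n)) ^ s * signedPod≤ (s ℕ.* 2)) n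
      ≈⟨ ∑<-head n _ n (λ s → tail n s) ⟩
    (1# * signedPod≤ 0) n
      ≈⟨ coeff (S.*-identityˡ (signedPod≤ 0)) n ⟩
    signedPod≤ 0 n
      ≈⟨ ≡⇒≋ (head n) ⟩
    1# n ∎
    where
    open ≈-Reasoning K.setoid
    bound : ∀ {i n} → i ℕ.≤ n → i ℕ.< suc n ℕ.* 2
    bound {i} {n} i≤n = ℕ.≤-trans (s≤s i≤n) (ℕ.m≤m*n (suc n) 2)
    head : ∀ n → signedPod≤ 0 n ≡ 1# n
    head zero    = refl
    head (suc n) = ℤ.*-zeroʳ (sign (suc n))
    tail : ∀ n s → ((q * y (suc n)) ^ suc s * signedPod≤ (suc s ℕ.* 2)) n ≋ + 0
    tail n s = K.trans (coeff (S.*-congʳ power) n) (q^-*-< (signedPod≤ (suc s ℕ.* 2)) n<e)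
      where
      e = 1 ℕ.+ suc n ℕ.* 2
      power : (q * y (suc n)) ^ suc s ≈ q^ (suc s ℕ.* e)
      power = S.trans (^-congˡ (suc s) (S.sym (q^2n+1 (suc n)))) (q^-^ e (suc s))
      n<e : n ℕ.< suc s ℕ.* e
      n<e = ℕ.≤-trans (ℕ.≤-trans (bound ℕ.≤-refl) (ℕ.n≤1+n _)) (ℕ.m≤m+n e (s ℕ.* e))

-- Extraction of the exponents 5n + 2

module Dissection where
  open CharacteristicFive
  open Triangular
  open SignedPod

  ^-local : ∀ k {f g N} → (∀ {i} → i ℕ.≤ N → f i ≋ g i) → ∀ {n} → n ℕ.≤ N → (f ^ k) n ≋ (g ^ k) n
  ^-local zero    f≋g n≤N = K.refl
  ^-local (suc k) f≋g {n} n≤N = *-local n (λ i≤n → f≋g (ℕ.≤-trans i≤n n≤N))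
    (λ i≤n → ^-local k f≋g (ℕ.≤-trans i≤n n≤N))

  ∑<-frobenius : ∀ n f → ∑< n f ^ 5 ≈ ∑< n (λ i → f i ^ 5)
  ∑<-frobenius zero    f = S.zeroˡ _
  ∑<-frobenius (suc n) f = S.trans (frobenius (∑< n f) (f n)) (S.+-congʳ (∑<-frobenius n f))

  ψ<-frobenius : ∀ n → ψ< n ^ 5 ≈ ∑< n (λ j → q^ (tri j ℕ.* 5))
  ψ<-frobenius n = S.trans (∑<-frobenius n (λ j → q^ tri j)) (∑<-cong n λ {j} _ →
    S.trans (q^-^ (tri j) 5) (q^-cong (ℕ.*-comm 5 (tri j))))

  -- The class 2 is the one with 8(5n + 2) + 4 = 5(8n + 4), so the relation between four odd squares
  -- at N and at 5N lives on these exponents.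
  U : Series → Series
  U f n = f (n ℕ.* 5 ℕ.+ 2)

  U-q^ : ∀ m f → U (q^ (m ℕ.* 5) * f) ≈ q^ m * U f
  U-q^ m f = coeffwise (go m)
    where
    go : ∀ m n → U (q^ (m ℕ.* 5) * f) n ≋ (q^ m * U f) n
    go zero    n = K.trans (coeff (q^0-* f) (n ℕ.* 5 ℕ.+ 2)) (K.sym (coeff (q^0-* (U f)) n))
    go (suc m) zero = K.trans (q^-*-< {suc m ℕ.* 5} {2} f (s<s (s<s z<s))) (K.sym (q^-*-< {suc m} (U f) z<s))
    go (suc m) (suc n) = begin
      (q^ (5 ℕ.+ m ℕ.* 5) * f) (5 ℕ.+ (n ℕ.* 5 ℕ.+ 2))
                               ≈⟨ q^-*-shift 5 (m ℕ.* 5) f (n ℕ.* 5 ℕ.+ 2) ⟩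
      U (q^ (m ℕ.* 5) * f) n   ≈⟨ go m n ⟩
      (q^ m * U f) n           ≈⟨ q^-*-suc m (U f) n ⟨
      (q^ suc m * U f) (suc n) ∎
      where open ≈-Reasoning K.setoid

  U-∑< : ∀ k (e : ℕ → ℕ) f → U (∑< k (λ j → q^ (e j ℕ.* 5)) * f) ≈ ∑< k (λ j → q^ e j) * U f
  U-∑< zero    e f = coeffwise λ n → K.trans (coeff (S.zeroˡ f) (n ℕ.* 5 ℕ.+ 2)) (K.sym (coeff (S.zeroˡ (U f)) n))
  U-∑< (suc k) e f = coeffwise λ n → begin
    ((∑< k Q⁵ + Q⁵ k) * f) (n ℕ.* 5 ℕ.+ 2)          ≈⟨ coeff (S.distribʳ f (∑< k Q⁵) (Q⁵ k)) (n ℕ.* 5 ℕ.+ 2) ⟩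
    U (∑< k Q⁵ * f) n ℤ.+ U (Q⁵ k * f) n
      ≈⟨ K.+-cong (coeff (U-∑< k e f) n) (coeff (U-q^ (e k) f) n) ⟩
    (∑< k Q * U f) n ℤ.+ (Q k * U f) n              ≈⟨ coeff (S.distribʳ (U f) (∑< k Q) (Q k)) n ⟨
    ((∑< k Q + Q k) * U f) n                        ∎
    where
    open ≈-Reasoning K.setoid
    Q Q⁵ : ℕ → Series
    Q j  = q^ e j
    Q⁵ j = q^ (e j ℕ.* 5)

  -- Modulo 5, ψ⁵ is a series in q⁵, which preserves exponent classes and leaves `U` with q⁵
  -- replaced by q. The argument runs on a truncation `ψ< N`, where Frobenius is applied to a finite
  -- sum.
  ψ*U≈U[ψ⁵*] : ∀ f → ψ * U f ≈ U (ψ ^ 5 * f)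
  ψ*U≈U[ψ⁵*] f = coeffwise λ n → let m = n ℕ.* 5 ℕ.+ 2 ; N = suc m in begin
    (ψ * U f) n
      ≈⟨ *-local n (λ i≤n → ψ<-≋-ψ (s≤s (ℕ.≤-trans i≤n (n≤m n)))) (λ _ → K.refl) ⟨
    (ψ< N * U f) n                                  ≈⟨ coeff (U-∑< N tri f) n ⟨
    (∑< N (λ j → q^ (tri j ℕ.* 5)) * f) m           ≈⟨ coeff (S.*-congʳ (ψ<-frobenius N)) m ⟨
    (ψ< N ^ 5 * f) m
      ≈⟨ *-local m (^-local 5 {N = m} (λ i≤m → ψ<-≋-ψ (s≤s i≤m))) (λ _ → K.refl) ⟩
    (ψ ^ 5 * f) m                                   ∎
    where
    open ≈-Reasoning K.setoid
    n≤m : ∀ n → n ℕ.≤ n ℕ.* 5 ℕ.+ 2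
    n≤m n = ℕ.≤-trans (ℕ.m≤m*n n 5) (ℕ.m≤m+n (n ℕ.* 5) 2)

  U-signedPod : U (ψ ^ 4) ≈ ψ ^ 4 → U signedPod ≈ ψ ^ 3
  U-signedPod Uψ⁴≈ψ⁴ = begin
    U P                    ≈⟨ S.*-identityˡ (U P) ⟨
    1# * U P               ≈⟨ S.*-congʳ ψ*signedPod≈1 ⟨
    ψ * P * U P            ≈⟨ solve 3 (λ a b c → a :* b :* c := b :* (a :* c)) S.refl ψ P (U P) ⟩
    P * (ψ * U P)          ≈⟨ S.*-congˡ (ψ*U≈U[ψ⁵*] P) ⟩
    P * U (ψ ^ 5 * P)      ≈⟨ S.*-congˡ (coeffwise λ n → coeff ψ⁵*P≈ψ⁴ (n ℕ.* 5 ℕ.+ 2)) ⟩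
    P * U (ψ ^ 4)          ≈⟨ S.*-congˡ Uψ⁴≈ψ⁴ ⟩
    P * ψ ^ 4              ≈⟨ solve 2 (λ a b → b :* a :^ 4 := a :* b :* a :^ 3) S.refl ψ P ⟩
    ψ * P * ψ ^ 3          ≈⟨ S.*-congʳ ψ*signedPod≈1 ⟩
    1# * ψ ^ 3             ≈⟨ S.*-identityˡ (ψ ^ 3) ⟩
    ψ ^ 3                  ∎
    where
    open Solver₅
    open ≈-Reasoning S.setoid
    P = signedPod
    ψ⁵*P≈ψ⁴ : ψ ^ 5 * P ≈ ψ ^ 4
    ψ⁵*P≈ψ⁴ = begin
      ψ ^ 5 * P            ≈⟨ solve 2 (λ a b → a :^ 5 :* b := a :* b :* a :^ 4) S.refl ψ P ⟩
      ψ * P * ψ ^ 4        ≈⟨ S.*-congʳ ψ*signedPod≈1 ⟩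
      1# * ψ ^ 4           ≈⟨ S.*-identityˡ (ψ ^ 4) ⟩
      ψ ^ 4                ∎

-- Sums of odd squares and powers of 2ψ

module OddSquares where
  open CharacteristicFive
  open import Data.List.Relation.Unary.All using ([]; _∷_)
  open Triangular
  open SignedPod
  open Dissection
  open import Data.List.Base using (map)

  q^-coeff-≡ : ∀ n → (q^ n) n ≡ + 1
  q^-coeff-≡ zero    = refl
  q^-coeff-≡ (suc n) = q^-coeff-≡ n

  q^-coeff-≢ : ∀ {m n} → m ≢ n → (q^ m) n ≡ + 0
  q^-coeff-≢ {zero}  {zero}  0≢0 with () ← 0≢0 refl
  q^-coeff-≢ {zero}  {suc n} _   = refl
  q^-coeff-≢ {suc m} {zero}  _   = refl
  q^-coeff-≢ {suc m} {suc n} m≢n = q^-coeff-≢ (m≢n ∘ cong suc)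

  module _ {a} {A : Set a} (w : A → ℕ) where

    generatingFunction : List A → Series
    generatingFunction []       = 0#
    generatingFunction (x ∷ xs) = q^ w x + generatingFunction xs

    generatingFunction-coeff : ∀ xs n → generatingFunction xs n ≋ + length (filter (λ x → w x ℕ.≟ n) xs)
    generatingFunction-coeff []       n = K.refl
    generatingFunction-coeff (x ∷ xs) n with w x ℕ.≟ n
    ... | yes wx≡n = K.trans
      (K.+-cong (≡⇒≋ (trans (cong (q^ w x) (sym wx≡n)) (q^-coeff-≡ (w x)))) (generatingFunction-coeff xs n))
      (≡⇒≋ (cong (+_ ∘ length) (sym (filter-accept (λ x → w x ℕ.≟ n) wx≡n))))
    ... | no  wx≢n = K.trans (K.+-cong (≡⇒≋ (q^-coeff-≢ wx≢n)) (generatingFunction-coeff xs n))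
      (K.trans (K.+-identityˡ _) (≡⇒≋ (cong (+_ ∘ length) (sym (filter-reject (λ x → w x ℕ.≟ n) wx≢n)))))

    generatingFunction-++ : ∀ xs ys → generatingFunction (xs ++ ys) ≈ generatingFunction xs + generatingFunction ys
    generatingFunction-++ []       ys = S.sym (S.+-identityˡ _)
    generatingFunction-++ (x ∷ xs) ys = S.trans
      (S.+-congˡ {q^ w x} (generatingFunction-++ xs ys))
      (S.sym (S.+-assoc (q^ w x) (generatingFunction xs) (generatingFunction ys)))

  -- This is a(a + 1)/2 for all integers a, so (2a + 1)² = 8 triℤ a + 1. Replacing x = 2a + 1 by -x
  -- exchanges a and -1 - a; hence every triangular number occurs twice and 2ψ appears in place of
  -- ψ.
  triℤ : ℤ → ℕ
  triℤ (+ j)    = tri j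
  triℤ -[1+ j ] = tri j

  weight : ∀ {d} → Vec ℤ d → ℕ
  weight []      = 0
  weight (a ∷ v) = triℤ a ℕ.+ weight v

  box : ℕ → List ℤ
  box N = map +_ (upTo N) ++ map -[1+_] (upTo N)

  boxes : ∀ d → ℕ → List (Vec ℤ d)
  boxes zero    N = [] ∷ []
  boxes (suc d) N = cartesianProductWith _∷_ (box N) (boxes d N)

  -- The solutions of x₁² + … + x_d² = 8n + d in odd integers x = 2a + 1, listed by a.
  opaque
    oddSquares : ∀ d → ℕ → List (Vec ℤ d)
    oddSquares d n = filter (λ v → weight v ℕ.≟ n) (boxes d (suc n))

  ∈-box : ∀ {a N} → triℤ a ℕ.< N → a ∈ box N
  ∈-box {+ j}      {N} t<N = ∈-++⁺ˡ (∈-map⁺ +_ (∈-upTo⁺ (ℕ.≤-<-trans (n≤tri j) t<N)))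
  ∈-box { -[1+ j ] } {N} t<N = ∈-++⁺ʳ (map +_ (upTo N)) (∈-map⁺ -[1+_] (∈-upTo⁺ (ℕ.≤-<-trans (n≤tri j) t<N)))

  ∈-boxes : ∀ {d} (v : Vec ℤ d) {N} → weight v ℕ.< N → v ∈ boxes d N
  ∈-boxes []      _   = here refl
  ∈-boxes (a ∷ v) w<N = ∈-cartesianProductWith⁺ _∷_
    (∈-box (ℕ.≤-<-trans (ℕ.m≤m+n (triℤ a) (weight v)) w<N)) (∈-boxes v (ℕ.≤-<-trans (ℕ.m≤n+m (weight v) (triℤ a)) w<N))

  opaque
    unfolding oddSquares

    ∈-oddSquares⁺ : ∀ {d} (v : Vec ℤ d) {n} → weight v ≡ n → v ∈ oddSquares d n
    ∈-oddSquares⁺ v refl = ∈-filter⁺ (λ v → weight v ℕ.≟ _) (∈-boxes v ℕ.≤-refl) refl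

    ∈-oddSquares⁻ : ∀ {d n} {v : Vec ℤ d} → v ∈ oddSquares d n → weight v ≡ n
    ∈-oddSquares⁻ {d} {n} v∈ = proj₂ (∈-filter⁻ (λ v → weight v ℕ.≟ n) {xs = boxes d (suc n)} v∈)

  box-unique : ∀ N → Unique (box N)
  box-unique N = Unique.++⁺ (Unique.map⁺ ℤ.+-injective (Unique.upTo⁺ N))
    (Unique.map⁺ ℤ.-[1+-injective (Unique.upTo⁺ N)) disjoint
    where
    disjoint : ∀ {a} → ¬ (a ∈ map +_ (upTo N) × a ∈ map -[1+_] (upTo N))
    disjoint (a∈₊ , a∈₋) with ∈-map⁻ +_ a∈₊ | ∈-map⁻ -[1+_] a∈₋
    ... | _ , _ , refl | _ , _ , ()

  boxes-unique : ∀ d N → Unique (boxes d N)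
  boxes-unique zero    N = [] ∷ []
  boxes-unique (suc d) N = Unique.cartesianProductWith⁺ _∷_ ∷-injective (box-unique N) (boxes-unique d N)

  opaque
    unfolding oddSquares

    oddSquares-unique : ∀ d n → Unique (oddSquares d n)
    oddSquares-unique d n = Unique.filter⁺ (λ v → weight v ℕ.≟ n) (boxes-unique d (suc n))

  generatingFunction-map-upTo : ∀ (f : ℕ → ℤ) → (∀ j → triℤ (f j) ≡ tri j) → ∀ N →
    generatingFunction triℤ (map f (upTo N)) ≈ ψ< N
  generatingFunction-map-upTo f tri-f zero    = S.refl
  generatingFunction-map-upTo f tri-f (suc N) = begin
    gf (map f (upTo (suc N)))            ≡⟨ cong (gf ∘ map f) (upTo-∷ʳ N) ⟨
    gf (map f (upTo N ∷ʳ N))             ≡⟨ cong gf (map-++ f (upTo N) (N ∷ [])) ⟩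
    gf (map f (upTo N) ++ f N ∷ [])      ≈⟨ generatingFunction-++ triℤ (map f (upTo N)) (f N ∷ []) ⟩
    gf (map f (upTo N)) + (q^ triℤ (f N) + 0#)
      ≈⟨ S.+-cong (generatingFunction-map-upTo f tri-f N) (S.trans (S.+-identityʳ _) (q^-cong (tri-f N))) ⟩
    ψ< N + q^ tri N                      ∎
    where
    open ≈-Reasoning S.setoid
    gf = generatingFunction triℤ

  generatingFunction-box : ∀ N → generatingFunction triℤ (box N) ≈ ψ< N + ψ< N
  generatingFunction-box N = S.trans (generatingFunction-++ triℤ (map +_ (upTo N)) (map -[1+_] (upTo N)))
    (S.+-cong (generatingFunction-map-upTo +_ (λ _ → refl) N) (generatingFunction-map-upTo -[1+_] (λ _ → refl) N))

  generatingFunction-map-∷ : ∀ {d} a (vs : List (Vec ℤ d)) →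
    generatingFunction weight (map (a ∷_) vs) ≈ q^ triℤ a * generatingFunction weight vs
  generatingFunction-map-∷ a []       = S.sym (S.zeroʳ (q^ triℤ a))
  generatingFunction-map-∷ a (v ∷ vs) = S.trans
    (S.+-cong (q^-+ (triℤ a) (weight v)) (generatingFunction-map-∷ a vs))
    (S.sym (S.distribˡ (q^ triℤ a) (q^ weight v) (generatingFunction weight vs)))

  generatingFunction-cartesianProductWith : ∀ {d} as (vs : List (Vec ℤ d)) →
    generatingFunction weight (cartesianProductWith _∷_ as vs) ≈
    generatingFunction triℤ as * generatingFunction weight vs
  generatingFunction-cartesianProductWith []       vs = S.sym (S.zeroˡ _)
  generatingFunction-cartesianProductWith (a ∷ as) vs = begin
    gf (map (a ∷_) vs ++ rest)                        ≈⟨ generatingFunction-++ weight (map (a ∷_) vs) rest ⟩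
    gf (map (a ∷_) vs) + gf rest
      ≈⟨ S.+-cong (generatingFunction-map-∷ a vs) (generatingFunction-cartesianProductWith as vs) ⟩
    q^ triℤ a * gf vs + generatingFunction triℤ as * gf vs
      ≈⟨ S.distribʳ (gf vs) (q^ triℤ a) (generatingFunction triℤ as) ⟨
    (q^ triℤ a + generatingFunction triℤ as) * gf vs  ∎
    where
    open ≈-Reasoning S.setoid
    rest = cartesianProductWith _∷_ as vs
    gf : ∀ {d} → List (Vec ℤ d) → Series
    gf = generatingFunction weight

  generatingFunction-boxes : ∀ d N → generatingFunction weight (boxes d N) ≈ (ψ< N + ψ< N) ^ d
  generatingFunction-boxes zero    N = S.+-identityʳ 1#
  generatingFunction-boxes (suc d) N = S.trans (generatingFunction-cartesianProductWith (box N) (boxes d N))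
    (S.*-cong (generatingFunction-box N) (generatingFunction-boxes d N))

  opaque
    unfolding oddSquares

    -- The box of size n + 1 generates the d-th power of twice the truncated ψ, which agrees with
    -- (2ψ)ᵈ up to qⁿ. Vectors of larger weight in the box do not matter there.
    length-oddSquares : ∀ d n → + length (oddSquares d n) ≋ ((ψ + ψ) ^ d) n
    length-oddSquares d n = begin
      + length (oddSquares d n)
        ≈⟨ generatingFunction-coeff weight (boxes d (suc n)) n ⟨
      generatingFunction weight (boxes d (suc n)) n        ≈⟨ coeff (generatingFunction-boxes d (suc n)) n ⟩
      ((ψ< (suc n) + ψ< (suc n)) ^ d) n
        ≈⟨ ^-local d {N = n} (λ i≤n → K.+-cong (ψ<-≋-ψ (s≤s i≤n)) (ψ<-≋-ψ (s≤s i≤n))) ℕ.≤-refl ⟩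
      ((ψ + ψ) ^ d) n                                      ∎
      where open ≈-Reasoning K.setoid

-- Similitudes from quaternions that preserve vectors of odd coordinates

module Similitudes where
  open Triangular using (tri)
  open OddSquares using (triℤ; weight)
  open import Data.Vec.Base using (map; zipWith)
  open import Data.Integer.Base using (_+_; _*_; -_; _-_)
  open ℤ-Solver using (solve-∀)
  open import Algebra.Properties.Group (AbelianGroup.group ℤ.+-0-abelianGroup) using ()
    renaming (∙-cancelˡ to +-cancelˡ)

  open ≡-Reasoning

  private variable
    d k l : ℕ

  infixl 6 _⊕_
  _⊕_ : Vec ℤ d → Vec ℤ d → Vec ℤ d
  _⊕_ = zipWith _+_

  scale : ℤ → Vec ℤ d → Vec ℤ d
  scale c = map (c *_)

  odd : Vec ℤ d → Vec ℤ d
  odd = map λ a → + 1 + + 2 * a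

  norm : Vec ℤ d → ℤ
  norm []      = + 0
  norm (x ∷ v) = x * x + norm v

  scale-scale : ∀ a b (v : Vec ℤ d) → scale a (scale b v) ≡ scale (a * b) v
  scale-scale a b []      = refl
  scale-scale a b (x ∷ v) = cong₂ _∷_ (sym (ℤ.*-assoc a b x)) (scale-scale a b v)

  scale-⊕ : ∀ c (u v : Vec ℤ d) → scale c (u ⊕ v) ≡ scale c u ⊕ scale c v
  scale-⊕ c []      []      = refl
  scale-⊕ c (x ∷ u) (y ∷ v) = cong₂ _∷_ (ℤ.*-distribˡ-+ c x y) (scale-⊕ c u v)

  norm-scale : ∀ c (v : Vec ℤ d) → norm (scale c v) ≡ c * c * norm v
  norm-scale c []      = sym (ℤ.*-zeroʳ (c * c))
  norm-scale c (x ∷ v) = trans (cong (λ n → c * x * (c * x) + n) (norm-scale c v)) (eq c x (norm v))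
    where
    eq : ∀ c x n → c * x * (c * x) + c * c * n ≡ c * c * (x * x + n)
    eq = solve-∀

  scale-cancel : ∀ k .{{_ : ℕ.NonZero k}} (u v : Vec ℤ d) → scale (+ k) u ≡ scale (+ k) v → u ≡ v
  scale-cancel k         []      []      _  = refl
  scale-cancel k@(suc _) (x ∷ u) (y ∷ v) eq =
    cong₂ _∷_ (ℤ.*-cancelˡ-≡ (+ k) x y (∷-injectiveˡ eq)) (scale-cancel k u v (∷-injectiveʳ eq))

  odd-injective : ∀ (u v : Vec ℤ d) → odd u ≡ odd v → u ≡ v
  odd-injective []      []      _  = refl
  odd-injective (a ∷ u) (b ∷ v) eq = cong₂ _∷_
    (ℤ.*-cancelˡ-≡ (+ 2) a b (+-cancelˡ (+ 1) (+ 2 * a) (+ 2 * b) (∷-injectiveˡ eq)))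
    (odd-injective u v (∷-injectiveʳ eq))

  -- An odd number divided by an odd number is odd: 1 + 2a = (1 + 2l) x rearranges to x = 1 + 2(a -
  -- l x), which gives the witness.
  odd-quotient : ∀ l (a v : Vec ℤ d) → odd a ≡ scale (+ 1 + + 2 * l) v → ∃ λ c → odd c ≡ v
  odd-quotient l []      []      _  = [] , refl
  odd-quotient l (a ∷ u) (x ∷ v) eq with odd-quotient l u v (∷-injectiveʳ eq)
  ... | c , odd-c = (a - l * x ∷ c) , cong₂ _∷_ (begin
    + 1 + + 2 * (a - l * x)                  ≡⟨ eq₁ a l x ⟩
    + 1 + + 2 * a - + 2 * l * x              ≡⟨ cong (_- + 2 * l * x) (∷-injectiveˡ eq) ⟩
    (+ 1 + + 2 * l) * x - + 2 * l * x        ≡⟨ eq₂ l x ⟩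
    x                                        ∎) odd-c
    where
    eq₁ : ∀ a l x → + 1 + + 2 * (a - l * x) ≡ + 1 + + 2 * a - + 2 * l * x
    eq₁ = solve-∀
    eq₂ : ∀ l x → (+ 1 + + 2 * l) * x - + 2 * l * x ≡ x
    eq₂ = solve-∀

  tri-square : ∀ j → + tri j * + 2 ≡ + j * (+ j + + 1)
  tri-square zero    = refl
  tri-square (suc j) = trans (ℤ.*-distribʳ-+ (+ 2) (+ suc j) (+ tri j))
    (trans (cong (λ t → + suc j * + 2 + t) (tri-square j)) (eq (+ j)))
    where
    eq : ∀ j → (+ 1 + j) * + 2 + j * (j + + 1) ≡ (+ 1 + j) * (+ 1 + j + + 1)
    eq = solve-∀

  odd-square : ∀ a → (+ 1 + + 2 * a) * (+ 1 + + 2 * a) ≡ + 8 * + triℤ a + + 1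
  odd-square (+ j) = trans (eq₁ (+ j)) (trans (cong (λ t → + 4 * t + + 1) (sym (tri-square j))) (eq₂ (+ tri j)))
    where
    eq₁ : ∀ j → (+ 1 + + 2 * j) * (+ 1 + + 2 * j) ≡ + 4 * (j * (j + + 1)) + + 1
    eq₁ = solve-∀
    eq₂ : ∀ t → + 4 * (t * + 2) + + 1 ≡ + 8 * t + + 1
    eq₂ = solve-∀
  odd-square -[1+ j ] = trans (eq₁ (+ j)) (odd-square (+ j))
    where
    eq₁ : ∀ j → (+ 1 + + 2 * - (+ 1 + j)) * (+ 1 + + 2 * - (+ 1 + j)) ≡ (+ 1 + + 2 * j) * (+ 1 + + 2 * j)
    eq₁ = solve-∀

  norm-odd : ∀ (v : Vec ℤ d) → norm (odd v) ≡ + (8 ℕ.* weight v ℕ.+ d)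
  norm-odd         []      = refl
  norm-odd {suc d} (a ∷ v) = begin
    (+ 1 + + 2 * a) * (+ 1 + + 2 * a) + norm (odd v)            ≡⟨ cong₂ _+_ (odd-square a) (norm-odd v) ⟩
    + 8 * + triℤ a + + 1 + + (8 ℕ.* weight v ℕ.+ d)
      ≡⟨ cong (λ w → + 8 * + triℤ a + + 1 + (w + + d)) (ℤ.pos-* 8 (weight v)) ⟩
    + 8 * + triℤ a + + 1 + (+ 8 * + weight v + + d)             ≡⟨ eq (+ triℤ a) (+ weight v) (+ d) ⟩
    + 8 * + (triℤ a ℕ.+ weight v) + + suc d
      ≡⟨ cong (_+ + suc d) (ℤ.pos-* 8 (triℤ a ℕ.+ weight v)) ⟨
    + (8 ℕ.* (triℤ a ℕ.+ weight v) ℕ.+ suc d)                   ∎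
    where
    eq : ∀ s t d → + 8 * s + + 1 + (+ 8 * t + d) ≡ + 8 * (s + t) + (+ 1 + d)
    eq = solve-∀

  -- `act` is the map seen on the parameters a of odd vectors 1 + 2a. It exists for maps congruent
  -- to the identity modulo 2, which is why quaternions of the form 1 ± 2i serve here, and for
  -- permutations of coordinates.
  record OddSimilarity (d k : ℕ) : Set where
    field
      fun       : Vec ℤ d → Vec ℤ d
      fun-⊕     : ∀ u v → fun (u ⊕ v) ≡ fun u ⊕ fun v
      fun-scale : ∀ c v → fun (scale c v) ≡ scale c (fun v)
      fun-norm  : ∀ v → norm (fun v) ≡ + k * norm v
      act       : Vec ℤ d → Vec ℤ d
      fun-odd   : ∀ a → fun (odd a) ≡ odd (act a)
  open OddSimilarity

  -- `from` is k times the inverse of `to`; for the quaternionic maps it comes from the conjugate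
  -- quaternion.
  record Similitude (d k : ℕ) : Set where
    field
      to      : OddSimilarity d k
      from    : OddSimilarity d k
      to∘from : ∀ v → fun to (fun from v) ≡ scale (+ k) v
      from∘to : ∀ v → fun from (fun to v) ≡ scale (+ k) v
  open Similitude

  inverse : Similitude d k → Similitude d k
  inverse R = record { to = from R ; from = to R ; to∘from = from∘to R ; from∘to = to∘from R }

  sandwich : OddSimilarity d 1 → OddSimilarity d k → OddSimilarity d 1 → OddSimilarity d k
  sandwich {k = k} E F G = record
    { fun       = fun E ∘ fun F ∘ fun G
    ; fun-⊕     = λ u v → trans (cong (fun E ∘ fun F) (fun-⊕ G u v)) (trans (cong (fun E) (fun-⊕ F _ _)) (fun-⊕ E _ _))
    ; fun-scale = λ c v → trans (cong (fun E ∘ fun F) (fun-scale G c v))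
        (trans (cong (fun E) (fun-scale F c _)) (fun-scale E c _))
    ; fun-norm  = λ v → begin
        norm (fun E (fun F (fun G v)))   ≡⟨ trans (fun-norm E _) (ℤ.*-identityˡ _) ⟩
        norm (fun F (fun G v))           ≡⟨ fun-norm F _ ⟩
        + k * norm (fun G v)             ≡⟨ cong (+ k *_) (trans (fun-norm G v) (ℤ.*-identityˡ _)) ⟩
        + k * norm v                     ∎
    ; act       = act E ∘ act F ∘ act G
    ; fun-odd   = λ a → trans (cong (fun E ∘ fun F) (fun-odd G a)) (trans (cong (fun E) (fun-odd F _)) (fun-odd E _))
    }

  scale-1 : ∀ (v : Vec ℤ d) → scale (+ 1) v ≡ v
  scale-1 []      = refl
  scale-1 (x ∷ v) = cong₂ _∷_ (ℤ.*-identityˡ x) (scale-1 v)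

  sandwich-round-trip : ∀ (ρ : Similitude d 1) (F G : OddSimilarity d k) → (∀ v → fun F (fun G v) ≡ scale (+ k) v) →
    ∀ v → fun (sandwich (from ρ) F (to ρ)) (fun (sandwich (from ρ) G (to ρ)) v) ≡ scale (+ k) v
  sandwich-round-trip {k = k} ρ F G FG v = begin
    ρ⁻¹ (fun F (ρ⁺ (ρ⁻¹ (fun G (ρ⁺ v)))))   ≡⟨ cong (ρ⁻¹ ∘ fun F) (trans (to∘from ρ _) (scale-1 _)) ⟩
    ρ⁻¹ (fun F (fun G (ρ⁺ v)))              ≡⟨ cong ρ⁻¹ (FG (ρ⁺ v)) ⟩
    ρ⁻¹ (scale (+ k) (ρ⁺ v))                ≡⟨ fun-scale (from ρ) (+ k) (ρ⁺ v) ⟩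
    scale (+ k) (ρ⁻¹ (ρ⁺ v))                ≡⟨ cong (scale (+ k)) (trans (from∘to ρ v) (scale-1 v)) ⟩
    scale (+ k) v                           ∎
    where
    ρ⁺ = fun (to ρ)
    ρ⁻¹ = fun (from ρ)

  -- With the cyclic permutation of i, j, k, an automorphism of the quaternions, as ρ, this carries
  -- 1 ± 2i to 1 ± 2j and 1 ± 2k. The polynomial identities are therefore needed for i only.
  conjugate : Similitude d 1 → Similitude d k → Similitude d k
  conjugate ρ R = record
    { to      = sandwich (from ρ) (to R) (to ρ)
    ; from    = sandwich (from ρ) (from R) (to ρ)
    ; to∘from = sandwich-round-trip ρ (to R) (from R) (to∘from R)
    ; from∘to = sandwich-round-trip ρ (from R) (to R) (from∘to R)
    }

  rotation₃ : Similitude 3 1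
  rotation₃ = record
    { to = record
      { fun       = λ { (x ∷ y ∷ z ∷ []) → y ∷ z ∷ x ∷ [] }
      ; fun-⊕     = λ { (_ ∷ _ ∷ _ ∷ []) (_ ∷ _ ∷ _ ∷ []) → refl }
      ; fun-scale = λ { _ (_ ∷ _ ∷ _ ∷ []) → refl }
      ; fun-norm  = λ { (x ∷ y ∷ z ∷ []) → eq₁ x y z }
      ; act       = λ { (x ∷ y ∷ z ∷ []) → y ∷ z ∷ x ∷ [] }
      ; fun-odd   = λ { (_ ∷ _ ∷ _ ∷ []) → refl }
      }
    ; from = record
      { fun       = λ { (x ∷ y ∷ z ∷ []) → z ∷ x ∷ y ∷ [] }
      ; fun-⊕     = λ { (_ ∷ _ ∷ _ ∷ []) (_ ∷ _ ∷ _ ∷ []) → refl }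
      ; fun-scale = λ { _ (_ ∷ _ ∷ _ ∷ []) → refl }
      ; fun-norm  = λ { (x ∷ y ∷ z ∷ []) → eq₂ x y z }
      ; act       = λ { (x ∷ y ∷ z ∷ []) → z ∷ x ∷ y ∷ [] }
      ; fun-odd   = λ { (_ ∷ _ ∷ _ ∷ []) → refl }
      }
    ; to∘from = λ { v@(_ ∷ _ ∷ _ ∷ []) → sym (scale-1 v) }
    ; from∘to = λ { v@(_ ∷ _ ∷ _ ∷ []) → sym (scale-1 v) }
    }
    where
    eq₁ : ∀ x y z → y * y + (z * z + (x * x + + 0)) ≡ + 1 * (x * x + (y * y + (z * z + + 0)))
    eq₁ = solve-∀
    eq₂ : ∀ x y z → z * z + (x * x + (y * y + + 0)) ≡ + 1 * (x * x + (y * y + (z * z + + 0)))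
    eq₂ = solve-∀

  rotation₄ : Similitude 4 1
  rotation₄ = record
    { to = record
      { fun       = λ { (w ∷ x ∷ y ∷ z ∷ []) → w ∷ y ∷ z ∷ x ∷ [] }
      ; fun-⊕     = λ { (_ ∷ _ ∷ _ ∷ _ ∷ []) (_ ∷ _ ∷ _ ∷ _ ∷ []) → refl }
      ; fun-scale = λ { _ (_ ∷ _ ∷ _ ∷ _ ∷ []) → refl }
      ; fun-norm  = λ { (w ∷ x ∷ y ∷ z ∷ []) → eq₁ w x y z }
      ; act       = λ { (w ∷ x ∷ y ∷ z ∷ []) → w ∷ y ∷ z ∷ x ∷ [] }
      ; fun-odd   = λ { (_ ∷ _ ∷ _ ∷ _ ∷ []) → refl }
      }
    ; from = record
      { fun       = λ { (w ∷ x ∷ y ∷ z ∷ []) → w ∷ z ∷ x ∷ y ∷ [] }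
      ; fun-⊕     = λ { (_ ∷ _ ∷ _ ∷ _ ∷ []) (_ ∷ _ ∷ _ ∷ _ ∷ []) → refl }
      ; fun-scale = λ { _ (_ ∷ _ ∷ _ ∷ _ ∷ []) → refl }
      ; fun-norm  = λ { (w ∷ x ∷ y ∷ z ∷ []) → eq₂ w x y z }
      ; act       = λ { (w ∷ x ∷ y ∷ z ∷ []) → w ∷ z ∷ x ∷ y ∷ [] }
      ; fun-odd   = λ { (_ ∷ _ ∷ _ ∷ _ ∷ []) → refl }
      }
    ; to∘from = λ { v@(_ ∷ _ ∷ _ ∷ _ ∷ []) → sym (scale-1 v) }
    ; from∘to = λ { v@(_ ∷ _ ∷ _ ∷ _ ∷ []) → sym (scale-1 v) }
    }
    where
    eq₁ : ∀ w x y z → w * w + (y * y + (z * z + (x * x + + 0))) ≡ + 1 * (w * w + (x * x + (y * y + (z * z + + 0))))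
    eq₁ = solve-∀
    eq₂ : ∀ w x y z → w * w + (z * z + (x * x + (y * y + + 0))) ≡ + 1 * (w * w + (x * x + (y * y + (z * z + + 0))))
    eq₂ = solve-∀

  -- Left multiplication of a + b i + c j + e k by 1 + 2t i.
  module LeftMultiplication where
    L : ℤ → Vec ℤ 4 → Vec ℤ 4
    L t (a ∷ b ∷ c ∷ e ∷ []) = a - + 2 * t * b ∷ b + + 2 * t * a ∷ c - + 2 * t * e ∷ e + + 2 * t * c ∷ []

    similarity : ∀ t → + 1 + + 4 * (t * t) ≡ + k → OddSimilarity 4 k
    similarity {k} t ≡k = record
      { fun       = L t
      ; fun-⊕     = λ { (a ∷ b ∷ c ∷ e ∷ []) (a′ ∷ b′ ∷ c′ ∷ e′ ∷ []) →
          cong₂ _∷_ (⊕₋ t a b a′ b′) (cong₂ _∷_ (⊕₊ t b a b′ a′)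
          (cong₂ _∷_ (⊕₋ t c e c′ e′) (cong₂ _∷_ (⊕₊ t e c e′ c′) refl))) }
      ; fun-scale = λ { s (a ∷ b ∷ c ∷ e ∷ []) →
          cong₂ _∷_ (scale₋ t s a b) (cong₂ _∷_ (scale₊ t s b a)
          (cong₂ _∷_ (scale₋ t s c e) (cong₂ _∷_ (scale₊ t s e c) refl))) }
      ; fun-norm  = λ { v@(a ∷ b ∷ c ∷ e ∷ []) → trans (norm-L t a b c e) (cong (_* norm v) ≡k) }
      ; act       = λ { (a ∷ b ∷ c ∷ e ∷ []) →
          a - t * (+ 1 + + 2 * b) ∷ b + t * (+ 1 + + 2 * a) ∷ c - t * (+ 1 + + 2 * e) ∷ e + t * (+ 1 + + 2 * c) ∷ [] }
      ; fun-odd   = λ { (a ∷ b ∷ c ∷ e ∷ []) →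
          cong₂ _∷_ (odd₋ t a b) (cong₂ _∷_ (odd₊ t b a) (cong₂ _∷_ (odd₋ t c e) (cong₂ _∷_ (odd₊ t e c) refl))) }
      }
      where
      ⊕₋ : ∀ t a b a′ b′ → a + a′ - + 2 * t * (b + b′) ≡ a - + 2 * t * b + (a′ - + 2 * t * b′)
      ⊕₋ = solve-∀
      ⊕₊ : ∀ t a b a′ b′ → a + a′ + + 2 * t * (b + b′) ≡ a + + 2 * t * b + (a′ + + 2 * t * b′)
      ⊕₊ = solve-∀
      scale₋ : ∀ t s a b → s * a - + 2 * t * (s * b) ≡ s * (a - + 2 * t * b)
      scale₋ = solve-∀
      scale₊ : ∀ t s a b → s * a + + 2 * t * (s * b) ≡ s * (a + + 2 * t * b)
      scale₊ = solve-∀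
      odd₋ : ∀ t a b → + 1 + + 2 * a - + 2 * t * (+ 1 + + 2 * b) ≡ + 1 + + 2 * (a - t * (+ 1 + + 2 * b))
      odd₋ = solve-∀
      odd₊ : ∀ t a b → + 1 + + 2 * a + + 2 * t * (+ 1 + + 2 * b) ≡ + 1 + + 2 * (a + t * (+ 1 + + 2 * b))
      odd₊ = solve-∀
      norm-L : ∀ t a b c e →
        (a - + 2 * t * b) * (a - + 2 * t * b) + ((b + + 2 * t * a) * (b + + 2 * t * a) +
        ((c - + 2 * t * e) * (c - + 2 * t * e) + ((e + + 2 * t * c) * (e + + 2 * t * c) + + 0))) ≡
        (+ 1 + + 4 * (t * t)) * (a * a + (b * b + (c * c + (e * e + + 0))))
      norm-L = solve-∀

    L∘L : ∀ t v → L t (L (- t) v) ≡ scale (+ 1 + + 4 * (t * t)) v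
    L∘L t (a ∷ b ∷ c ∷ e ∷ []) = cong₂ _∷_ (eq₁ t a b) (cong₂ _∷_ (eq₂ t b a)
      (cong₂ _∷_ (eq₁ t c e) (cong₂ _∷_ (eq₂ t e c) refl)))
      where
      eq₁ : ∀ t a b → a - + 2 * - t * b - + 2 * t * (b + + 2 * - t * a) ≡ (+ 1 + + 4 * (t * t)) * a
      eq₁ = solve-∀
      eq₂ : ∀ t a b → a + + 2 * - t * b + + 2 * t * (b - + 2 * - t * a) ≡ (+ 1 + + 4 * (t * t)) * a
      eq₂ = solve-∀

  -- The map v ↦ q v q̄ on the pure quaternions, where q = 1 + 2t i.
  module Conjugation where
    C : ℤ → Vec ℤ 3 → Vec ℤ 3
    C t (x ∷ y ∷ z ∷ []) =
      (+ 1 + + 4 * (t * t)) * x ∷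
      (+ 1 - + 4 * (t * t)) * y - + 4 * t * z ∷
      + 4 * t * y + (+ 1 - + 4 * (t * t)) * z ∷ []

    similarity : ∀ t → (+ 1 + + 4 * (t * t)) * (+ 1 + + 4 * (t * t)) ≡ + k → OddSimilarity 3 k
    similarity {k} t ≡k = record
      { fun       = C t
      ; fun-⊕     = λ { (x ∷ y ∷ z ∷ []) (x′ ∷ y′ ∷ z′ ∷ []) →
          cong₂ _∷_ (ℤ.*-distribˡ-+ (+ 1 + + 4 * (t * t)) x x′)
          (cong₂ _∷_ (⊕₂ t y z y′ z′) (cong₂ _∷_ (⊕₃ t y z y′ z′) refl)) }
      ; fun-scale = λ { s (x ∷ y ∷ z ∷ []) →
          cong₂ _∷_ (scale₁ t s x) (cong₂ _∷_ (scale₂ t s y z) (cong₂ _∷_ (scale₃ t s y z) refl)) }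
      ; fun-norm  = λ { v@(x ∷ y ∷ z ∷ []) → trans (norm-C t x y z) (cong (_* norm v) ≡k) }
      ; act       = λ { (x ∷ y ∷ z ∷ []) →
          x + + 2 * (t * t) * (+ 1 + + 2 * x) ∷
          y - (+ 2 * (t * t) * (+ 1 + + 2 * y) + + 2 * t * (+ 1 + + 2 * z)) ∷
          z - (+ 2 * (t * t) * (+ 1 + + 2 * z) - + 2 * t * (+ 1 + + 2 * y)) ∷ [] }
      ; fun-odd   = λ { (x ∷ y ∷ z ∷ []) → cong₂ _∷_ (odd₁ t x) (cong₂ _∷_ (odd₂ t y z) (cong₂ _∷_ (odd₃ t y z) refl)) }
      }
      where
      ⊕₂ : ∀ t y z y′ z′ → (+ 1 - + 4 * (t * t)) * (y + y′) - + 4 * t * (z + z′) ≡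
        ((+ 1 - + 4 * (t * t)) * y - + 4 * t * z) + ((+ 1 - + 4 * (t * t)) * y′ - + 4 * t * z′)
      ⊕₂ = solve-∀
      ⊕₃ : ∀ t y z y′ z′ → + 4 * t * (y + y′) + (+ 1 - + 4 * (t * t)) * (z + z′) ≡
        (+ 4 * t * y + (+ 1 - + 4 * (t * t)) * z) + (+ 4 * t * y′ + (+ 1 - + 4 * (t * t)) * z′)
      ⊕₃ = solve-∀
      scale₁ : ∀ t s x → (+ 1 + + 4 * (t * t)) * (s * x) ≡ s * ((+ 1 + + 4 * (t * t)) * x)
      scale₁ = solve-∀
      scale₂ : ∀ t s y z → (+ 1 - + 4 * (t * t)) * (s * y) - + 4 * t * (s * z) ≡
        s * ((+ 1 - + 4 * (t * t)) * y - + 4 * t * z)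
      scale₂ = solve-∀
      scale₃ : ∀ t s y z → + 4 * t * (s * y) + (+ 1 - + 4 * (t * t)) * (s * z) ≡
        s * (+ 4 * t * y + (+ 1 - + 4 * (t * t)) * z)
      scale₃ = solve-∀
      odd₁ : ∀ t x → (+ 1 + + 4 * (t * t)) * (+ 1 + + 2 * x) ≡ + 1 + + 2 * (x + + 2 * (t * t) * (+ 1 + + 2 * x))
      odd₁ = solve-∀
      odd₂ : ∀ t y z → (+ 1 - + 4 * (t * t)) * (+ 1 + + 2 * y) - + 4 * t * (+ 1 + + 2 * z) ≡
        + 1 + + 2 * (y - (+ 2 * (t * t) * (+ 1 + + 2 * y) + + 2 * t * (+ 1 + + 2 * z)))
      odd₂ = solve-∀
      odd₃ : ∀ t y z → + 4 * t * (+ 1 + + 2 * y) + (+ 1 - + 4 * (t * t)) * (+ 1 + + 2 * z) ≡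
        + 1 + + 2 * (z - (+ 2 * (t * t) * (+ 1 + + 2 * z) - + 2 * t * (+ 1 + + 2 * y)))
      odd₃ = solve-∀
      norm-C : ∀ t x y z →
        (+ 1 + + 4 * (t * t)) * x * ((+ 1 + + 4 * (t * t)) * x) +
        (((+ 1 - + 4 * (t * t)) * y - + 4 * t * z) * ((+ 1 - + 4 * (t * t)) * y - + 4 * t * z) +
        ((+ 4 * t * y + (+ 1 - + 4 * (t * t)) * z) * (+ 4 * t * y + (+ 1 - + 4 * (t * t)) * z) + + 0)) ≡
        (+ 1 + + 4 * (t * t)) * (+ 1 + + 4 * (t * t)) * (x * x + (y * y + (z * z + + 0)))
      norm-C = solve-∀

    C∘C : ∀ t v → C t (C (- t) v) ≡ scale ((+ 1 + + 4 * (t * t)) * (+ 1 + + 4 * (t * t))) v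
    C∘C t (x ∷ y ∷ z ∷ []) = cong₂ _∷_ (eq₁ t x) (cong₂ _∷_ (eq₂ t y z) (cong₂ _∷_ (eq₃ t y z) refl))
      where
      eq₁ : ∀ t x → (+ 1 + + 4 * (t * t)) * ((+ 1 + + 4 * (- t * - t)) * x) ≡
        (+ 1 + + 4 * (t * t)) * (+ 1 + + 4 * (t * t)) * x
      eq₁ = solve-∀
      eq₂ : ∀ t y z →
        (+ 1 - + 4 * (t * t)) * ((+ 1 - + 4 * (- t * - t)) * y - + 4 * - t * z)
          - + 4 * t * (+ 4 * - t * y + (+ 1 - + 4 * (- t * - t)) * z) ≡
        (+ 1 + + 4 * (t * t)) * (+ 1 + + 4 * (t * t)) * y
      eq₂ = solve-∀
      eq₃ : ∀ t y z →
        + 4 * t * ((+ 1 - + 4 * (- t * - t)) * y - + 4 * - t * z)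
          + (+ 1 - + 4 * (t * t)) * (+ 4 * - t * y + (+ 1 - + 4 * (- t * - t)) * z) ≡
        (+ 1 + + 4 * (t * t)) * (+ 1 + + 4 * (t * t)) * z
      eq₃ = solve-∀

  leftMultiplication₅ : Similitude 4 5
  leftMultiplication₅ = record
    { to = similarity (+ 1) refl ; from = similarity (- + 1) refl ; to∘from = L∘L (+ 1) ; from∘to = L∘L (- + 1) }
    where open LeftMultiplication

  conjugation₂₅ : Similitude 3 25
  conjugation₂₅ = record
    { to = similarity (+ 1) refl ; from = similarity (- + 1) refl ; to∘from = C∘C (+ 1) ; from∘to = C∘C (- + 1) }
    where open Conjugation

  scaling : ∀ l → OddSimilarity d ((1 ℕ.+ 2 ℕ.* l) ℕ.* (1 ℕ.+ 2 ℕ.* l))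
  scaling l = record
    { fun       = scale c
    ; fun-⊕     = scale-⊕ c
    ; fun-scale = λ s v → trans (scale-scale c s v)
        (trans (cong (λ e → scale e v) (ℤ.*-comm c s)) (sym (scale-scale s c v)))
    ; fun-norm  = λ v → trans (norm-scale c v) (cong (_* norm v) (sym (ℤ.pos-* (1 ℕ.+ 2 ℕ.* l) (1 ℕ.+ 2 ℕ.* l))))
    ; act       = map λ a → a + + l * (+ 1 + + 2 * a)
    ; fun-odd   = scale-odd
    }
    where
    c = + (1 ℕ.+ 2 ℕ.* l)
    eq : ∀ l a → (+ 1 + + 2 * l) * (+ 1 + + 2 * a) ≡ + 1 + + 2 * (a + l * (+ 1 + + 2 * a))
    eq = solve-∀
    scale-odd : ∀ {d} (v : Vec ℤ d) → scale c (odd v) ≡ odd (map (λ a → a + + l * (+ 1 + + 2 * a)) v)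
    scale-odd []      = refl
    scale-odd (a ∷ v) = cong₂ _∷_
      (trans (cong (λ e → (+ 1 + e) * (+ 1 + + 2 * a)) (ℤ.pos-* 2 l)) (eq (+ l) a)) (scale-odd v)

  scaling₂₅ : Similitude d 25
  scaling₂₅ = record
    { to = scaling 2 ; from = scaling 2 ; to∘from = scale-scale (+ 5) (+ 5) ; from∘to = scale-scale (+ 5) (+ 5) }

-- Representations in the image of a similitude

module Images where
  open OddSquares
  open Similitudes
  open import Data.Vec.Relation.Unary.All as All using (All; []; _∷_)
  open import Data.Integer.Base using (_+_; _*_)
  open import Data.Integer.Divisibility.Signed using (_∣_; _∣?_; divides)

  open ≡-Reasoning
  open OddSimilarity
  open Similitude

  private variable
    d k l : ℕ

  length-bijection : ∀ {a} {A B : Set a} {xs : List A} {ys : List B} → Unique xs → Unique ys →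
    (f : A → B) → (∀ {x y} → f x ≡ f y → x ≡ y) → (∀ {x} → x ∈ xs → f x ∈ ys) →
    (∀ {y} → y ∈ ys → ∃ λ x → x ∈ xs × f x ≡ y) → length xs ≡ length ys
  length-bijection {xs = xs} {ys} xs! ys! f f-inj f∈ f-onto = trans (sym (length-map f xs))
    (↭-length (∼bag⇒↭ (unique∧set⇒bag (Unique.map⁺ f-inj xs!) ys! (mk⇔ to′ from′))))
    where
    to′ : ∀ {y} → y ∈ List.map f xs → y ∈ ys
    to′ y∈ with ∈-map⁻ f y∈
    ... | _ , x∈ , refl = f∈ x∈
    from′ : ∀ {y} → y ∈ ys → y ∈ List.map f xs
    from′ y∈ with f-onto y∈
    ... | _ , x∈ , refl = ∈-map⁺ f x∈

  Divisible : ℕ → Vec ℤ d → Set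
  Divisible k = All (+ k ∣_)

  divisible? : ∀ k → Decidable (Divisible {d} k)
  divisible? k = All.all? (+ k ∣?_)

  divisible-scale : ∀ k (v : Vec ℤ d) → Divisible k (scale (+ k) v)
  divisible-scale k []      = []
  divisible-scale k (x ∷ v) = divides x (ℤ.*-comm (+ k) x) ∷ divisible-scale k v

  divisible-quotient : ∀ {v : Vec ℤ d} → Divisible k v → ∃ λ u → v ≡ scale (+ k) u
  divisible-quotient []                                = [] , refl
  divisible-quotient {k = k} (divides x refl ∷ v-div) with divisible-quotient v-div
  ... | u , refl = x ∷ u , cong₂ _∷_ (ℤ.*-comm x (+ k)) refl

  -- Since `to` and `from` compose to k, w = `to` v holds exactly when `from` w = k v. Membership in
  -- the image becomes a divisibility, which is decidable and depends only on w modulo k.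
  InImage : Similitude d k → Vec ℤ d → Set
  InImage {k = k} R w = Divisible k (fun (from R) w)

  inImage? : ∀ (R : Similitude d k) → Decidable (InImage R)
  inImage? {k = k} R w = divisible? k (fun (from R) w)

  module _ (R : Similitude d (1 ℕ.+ 2 ℕ.* l)) {n n′ : ℕ}
    (n′≡ : 8 ℕ.* n′ ℕ.+ d ≡ (1 ℕ.+ 2 ℕ.* l) ℕ.* (8 ℕ.* n ℕ.+ d)) where
    private
      κ = 1 ℕ.+ 2 ℕ.* l

    act-injective : ∀ {a b} → act (to R) a ≡ act (to R) b → a ≡ b
    act-injective {a} {b} eq = odd-injective a b (scale-cancel κ (odd a) (odd b) (begin
      scale (+ κ) (odd a)                   ≡⟨ from∘to R (odd a) ⟨
      fun (from R) (fun (to R) (odd a))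
        ≡⟨ cong (fun (from R)) (trans (fun-odd (to R) a) (trans (cong odd eq) (sym (fun-odd (to R) b)))) ⟩
      fun (from R) (fun (to R) (odd b))     ≡⟨ from∘to R (odd b) ⟩
      scale (+ κ) (odd b)                   ∎))

    weight-act : ∀ a → 8 ℕ.* weight (act (to R) a) ℕ.+ d ≡ κ ℕ.* (8 ℕ.* weight a ℕ.+ d)
    weight-act a = ℤ.+-injective (begin
      + (8 ℕ.* weight (act (to R) a) ℕ.+ d)   ≡⟨ norm-odd (act (to R) a) ⟨
      norm (odd (act (to R) a))               ≡⟨ cong norm (fun-odd (to R) a) ⟨
      norm (fun (to R) (odd a))               ≡⟨ fun-norm (to R) (odd a) ⟩
      + κ * norm (odd a)                      ≡⟨ cong (+ κ *_) (norm-odd a) ⟩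
      + κ * + (8 ℕ.* weight a ℕ.+ d)          ≡⟨ ℤ.pos-* κ (8 ℕ.* weight a ℕ.+ d) ⟨
      + (κ ℕ.* (8 ℕ.* weight a ℕ.+ d))        ∎)

    8w+d-injective : ∀ w w′ → 8 ℕ.* w ℕ.+ d ≡ 8 ℕ.* w′ ℕ.+ d → w ≡ w′
    8w+d-injective w w′ eq = ℕ.*-cancelˡ-≡ w w′ 8 (ℕ.+-cancelʳ-≡ d (8 ℕ.* w) (8 ℕ.* w′) eq)

    act-∈ : ∀ {a} → a ∈ oddSquares d n → act (to R) a ∈ filter (inImage? R ∘ odd) (oddSquares d n′)
    act-∈ {a} a∈ = ∈-filter⁺ (inImage? R ∘ odd)
      (∈-oddSquares⁺ (act (to R) a) (8w+d-injective _ n′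
        (trans (weight-act a) (trans (cong (λ w → κ ℕ.* (8 ℕ.* w ℕ.+ d)) (∈-oddSquares⁻ a∈)) (sym n′≡)))))
      (subst (Divisible κ) (trans (sym (from∘to R (odd a))) (cong (fun (from R)) (fun-odd (to R) a)))
        (divisible-scale κ (odd a)))

    act-onto : ∀ {b} → b ∈ filter (inImage? R ∘ odd) (oddSquares d n′) → ∃ λ a → a ∈ oddSquares d n × act (to R) a ≡ b
    act-onto {b} b∈ with ∈-filter⁻ (inImage? R ∘ odd) {xs = oddSquares d n′} b∈
    ... | b∈′ , div with divisible-quotient div
    -- The preimage of b is `from` b divided by κ. Its coordinates are odd because κ and the
    -- coordinates of `from` b are.
    ...   | v , from-b with odd-quotient (+ l) (act (from R) b) v (begin
            odd (act (from R) b)       ≡⟨ fun-odd (from R) b ⟨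
            fun (from R) (odd b)       ≡⟨ from-b ⟩
            scale (+ κ) v              ≡⟨ cong (λ c → scale (+ 1 + c) v) (ℤ.pos-* 2 l) ⟩
            scale (+ 1 + + 2 * + l) v  ∎)
    ...     | a , refl = a , ∈-oddSquares⁺ a weight-a , act-a
      where
      act-a : act (to R) a ≡ b
      act-a = odd-injective _ b (scale-cancel κ _ (odd b) (begin
        scale (+ κ) (odd (act (to R) a))    ≡⟨ cong (scale (+ κ)) (fun-odd (to R) a) ⟨
        scale (+ κ) (fun (to R) (odd a))    ≡⟨ fun-scale (to R) (+ κ) (odd a) ⟨
        fun (to R) (scale (+ κ) (odd a))    ≡⟨ cong (fun (to R)) from-b ⟨
        fun (to R) (fun (from R) (odd b))   ≡⟨ to∘from R (odd b) ⟩
        scale (+ κ) (odd b)                 ∎))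
      weight-a : weight a ≡ n
      weight-a = 8w+d-injective (weight a) n (ℕ.*-cancelˡ-≡ _ _ κ (begin
        κ ℕ.* (8 ℕ.* weight a ℕ.+ d)          ≡⟨ weight-act a ⟨
        8 ℕ.* weight (act (to R) a) ℕ.+ d     ≡⟨ cong (λ b → 8 ℕ.* weight b ℕ.+ d) act-a ⟩
        8 ℕ.* weight b ℕ.+ d                  ≡⟨ cong (λ w → 8 ℕ.* w ℕ.+ d) (∈-oddSquares⁻ b∈′) ⟩
        8 ℕ.* n′ ℕ.+ d                        ≡⟨ n′≡ ⟩
        κ ℕ.* (8 ℕ.* n ℕ.+ d)                 ∎))

    -- The bijection is `act (to R)`: multiplying the norm by κ carries 8n + d to 8n′ + d, and
    -- `from` undoes the map up to the factor κ.
    length-image : length (oddSquares d n) ≡ length (filter (inImage? R ∘ odd) (oddSquares d n′))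
    length-image = length-bijection (oddSquares-unique d n)
      (Unique.filter⁺ (inImage? R ∘ odd) (oddSquares-unique d n′)) (act (to R)) act-injective act-∈ act-onto

  length-filter-∷ : ∀ {a p} {A : Set a} {P : Pred A p} (P? : Decidable P) x xs →
    length (filter P? (x ∷ xs)) ≡ length (filter P? (x ∷ [])) ℕ.+ length (filter P? xs)
  length-filter-∷ P? x xs with P? x
  ... | yes _ = refl
  ... | no  _ = refl

  sum-length-filter : ∀ {a b p} {A : Set a} {B : Set b} {P : A → Pred B p} (P? : ∀ x → Decidable (P x)) xs ys →
    sum (List.map (λ x → length (filter (P? x) ys)) xs) ≡ sum (List.map (λ y → length (filter (λ x → P? x y) xs)) ys)
  sum-length-filter P? []       []       = refl
  sum-length-filter P? []       (y ∷ ys) = sum-length-filter P? [] ys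
  sum-length-filter {A = A} {B} P? (x ∷ xs) ys = begin
    length (filter (P? x) ys) ℕ.+ sum (List.map (λ x → length (filter (P? x) ys)) xs)
      ≡⟨ cong (length (filter (P? x) ys) ℕ.+_) (sum-length-filter P? xs ys) ⟩
    length (filter (P? x) ys) ℕ.+ sum (List.map (λ y → length (filter (λ x → P? x y) xs)) ys)
      ≡⟨ add-row ys ⟩
    sum (List.map (λ y → length (filter (λ x → P? x y) (x ∷ xs))) ys) ∎
    where
    row : List A → B → ℕ
    row xs y = length (filter (λ x → P? x y) xs)
    interchange : ∀ a b c d → (a ℕ.+ b) ℕ.+ (c ℕ.+ d) ≡ (a ℕ.+ c) ℕ.+ (b ℕ.+ d)
    interchange = ℕ-Solver.solve-∀
    single : ∀ y → length (filter (P? x) (y ∷ [])) ≡ row (x ∷ []) y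
    single y with P? x y
    ... | yes _ = refl
    ... | no  _ = refl
    add-row : ∀ ys → length (filter (P? x) ys) ℕ.+ sum (List.map (row xs) ys) ≡ sum (List.map (row (x ∷ xs)) ys)
    add-row []       = refl
    add-row (y ∷ ys) = begin
      length (filter (P? x) (y ∷ ys)) ℕ.+ (row xs y ℕ.+ sum (List.map (row xs) ys))
        ≡⟨ cong (ℕ._+ (row xs y ℕ.+ sum (List.map (row xs) ys)))
             (trans (length-filter-∷ (P? x) y ys) (cong (ℕ._+ length (filter (P? x) ys)) (single y))) ⟩
      row (x ∷ []) y ℕ.+ length (filter (P? x) ys) ℕ.+ (row xs y ℕ.+ sum (List.map (row xs) ys))
        ≡⟨ interchange (row (x ∷ []) y) _ (row xs y) _ ⟩
      row (x ∷ []) y ℕ.+ row xs y ℕ.+ (length (filter (P? x) ys) ℕ.+ sum (List.map (row xs) ys))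
        ≡⟨ cong₂ ℕ._+_ (sym (length-filter-∷ (λ x → P? x y) x xs)) (add-row ys) ⟩
      row (x ∷ xs) y ℕ.+ sum (List.map (row (x ∷ xs)) ys) ∎

-- Hecke relations modulo 5 for three and four odd squares

module Hecke where
  open import Data.Vec.Relation.Unary.All using ([]; _∷_)
  open CharacteristicFive using (_≋_; ≡⇒≋; congruent; module K)
  open PodRecurrences using (length-filter-cong)
  open OddSquares
  open Similitudes
  open Images
  open import Data.Integer.Base using (_+_; _*_; _-_)
  open import Data.Integer.Divisibility.Signed using (_∣_; _∣?_; divides; ∣m∣n⇒∣m+n; ∣m+n∣n⇒∣m)
  open import Data.Nat.Base using (_%_; _/_)
  open ℤ-Solver using (solve-∀)

  open ≡-Reasoning
  open OddSimilarity
  open Similitude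

  private variable
    d k l : ℕ

  imageCount : List (Similitude d k) → Vec ℤ d → ℕ
  imageCount Rs w = length (filter (λ R → inImage? R w) Rs)

  %5≡1⇒≋1 : ∀ m → m % 5 ≡ 1 → + m ≋ + 1
  %5≡1⇒≋1 m m%5≡1 = congruent (+ (m / 5))
    (trans (cong +_ (trans (m≡m%n+[m/n]*n m 5) (cong (ℕ._+ m / 5 ℕ.* 5) m%5≡1)))
           (cong (λ c → + 1 + c) (ℤ.pos-* (m / 5) 5)))

  sum-≋-length : ∀ {a} {A : Set a} (f : A → ℕ) xs → (∀ {x} → x ∈ xs → + f x ≋ + 1) → + sum (List.map f xs) ≋ + length xs
  sum-≋-length f []       f≋1 = K.refl
  sum-≋-length f (x ∷ xs) f≋1 = K.+-cong (f≋1 (here refl)) (sum-≋-length f xs (f≋1 ∘ there))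

  sum-const : ∀ {a} {A : Set a} (f : A → ℕ) c xs → (∀ x → f x ≡ c) → sum (List.map f xs) ≡ length xs ℕ.* c
  sum-const f c []       f≡c = refl
  sum-const f c (x ∷ xs) f≡c = cong₂ ℕ._+_ (f≡c x) (sum-const f c xs f≡c)

  -- Double counting of the pairs (R, b) such that odd b lies in the image of R.
  hecke : ∀ (Rs : List (Similitude d (1 ℕ.+ 2 ℕ.* l))) {n n′} →
    8 ℕ.* n′ ℕ.+ d ≡ (1 ℕ.+ 2 ℕ.* l) ℕ.* (8 ℕ.* n ℕ.+ d) →
    (∀ {b} → b ∈ oddSquares d n′ → imageCount Rs (odd b) % 5 ≡ 1) →
    + length (oddSquares d n′) ≋ + (length Rs ℕ.* length (oddSquares d n))
  hecke {d} {l} Rs {n} {n′} n′≡ count≡1 = K.sym (K.trans (≡⇒≋ (cong +_ double-count))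
    (sum-≋-length (imageCount Rs ∘ odd) (oddSquares d n′) λ b∈ → %5≡1⇒≋1 _ (count≡1 b∈)))
    where
    double-count : length Rs ℕ.* length (oddSquares d n) ≡ sum (List.map (imageCount Rs ∘ odd) (oddSquares d n′))
    double-count = trans
      (sym (sum-const (λ R → length (filter (inImage? R ∘ odd) (oddSquares d n′))) _ Rs
        λ R → sym (length-image {d} {l} R n′≡)))
      (sum-length-filter (λ R → inImage? R ∘ odd) Rs (oddSquares d n′))

  residue : ∀ k .{{_ : ℕ.NonZero k}} → Vec ℤ d → Vec ℤ d
  residue k = Vec.map λ x → + (x %ℕ k)

  quotients : ∀ k .{{_ : ℕ.NonZero k}} → Vec ℤ d → Vec ℤ d
  quotients k = Vec.map (_/ℕ k)

  residue-⊕-quotients : ∀ k .{{_ : ℕ.NonZero k}} (w : Vec ℤ d) → w ≡ residue k w ⊕ scale (+ k) (quotients k w)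
  residue-⊕-quotients k []      = refl
  residue-⊕-quotients k (x ∷ w) = cong₂ _∷_
    (trans (a≡a%ℕn+[a/ℕn]*n x k) (cong (λ c → + (x %ℕ k) + c) (ℤ.*-comm (x /ℕ k) (+ k)))) (residue-⊕-quotients k w)

  residues : ∀ d → ℕ → List (Vec ℤ d)
  residues zero    k = [] ∷ []
  residues (suc d) k = cartesianProductWith _∷_ (List.map +_ (upTo k)) (residues d k)

  ∈-residues : ∀ k .{{_ : ℕ.NonZero k}} (w : Vec ℤ d) → residue k w ∈ residues d k
  ∈-residues k []      = here refl
  ∈-residues k (x ∷ w) = ∈-cartesianProductWith⁺ _∷_ (∈-map⁺ +_ (∈-upTo⁺ (n%ℕd<d x k))) (∈-residues k w)

  divisible-⊕ : ∀ k (u t : Vec ℤ d) → Divisible k (u ⊕ scale (+ k) t) ⇔ Divisible k u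
  divisible-⊕ k u t = mk⇔ (to′ u t) (from′ u t)
    where
    k∣ : ∀ s → + k ∣ + k * s
    k∣ s = divides s (ℤ.*-comm (+ k) s)
    to′ : ∀ {d} (u t : Vec ℤ d) → Divisible k (u ⊕ scale (+ k) t) → Divisible k u
    to′ []      []      []         = []
    to′ (x ∷ u) (s ∷ t) (px ∷ pu) = ∣m+n∣n⇒∣m {m = x} {+ k * s} px (k∣ s) ∷ to′ u t pu
    from′ : ∀ {d} (u t : Vec ℤ d) → Divisible k u → Divisible k (u ⊕ scale (+ k) t)
    from′ []      []      []        = []
    from′ (x ∷ u) (s ∷ t) (px ∷ pu) = ∣m∣n⇒∣m+n px (k∣ s) ∷ from′ u t pu

  -- Each `from R` is linear, so changing w by a multiple of k changes `from R` w by a multiple of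
  -- k. This makes the count a finite computation.
  imageCount-residue : ∀ .{{_ : ℕ.NonZero k}} (Rs : List (Similitude d k)) w →
    imageCount Rs w ≡ imageCount Rs (residue k w)
  imageCount-residue {k} Rs w = length-filter-cong _ _ Rs λ {R} _ →
    subst (λ u → Divisible k u ⇔ InImage R (residue k w)) (sym (from-w R))
      (divisible-⊕ k (fun (from R) (residue k w)) (fun (from R) (quotients k w)))
    where
    from-w : ∀ R → fun (from R) w ≡ fun (from R) (residue k w) ⊕ scale (+ k) (fun (from R) (quotients k w))
    from-w R = begin
      fun (from R) w
        ≡⟨ cong (fun (from R)) (residue-⊕-quotients k w) ⟩
      fun (from R) (residue k w ⊕ scale (+ k) (quotients k w))              ≡⟨ fun-⊕ (from R) _ _ ⟩
      fun (from R) (residue k w) ⊕ fun (from R) (scale (+ k) (quotients k w))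
        ≡⟨ cong (fun (from R) (residue k w) ⊕_) (fun-scale (from R) (+ k) _) ⟩
      fun (from R) (residue k w) ⊕ scale (+ k) (fun (from R) (quotients k w)) ∎

  dot : Vec ℤ d → Vec ℤ d → ℤ
  dot []      []      = + 0
  dot (x ∷ u) (y ∷ v) = x * y + dot u v

  norm-⊕ : ∀ (u v : Vec ℤ d) → norm (u ⊕ v) ≡ norm u + + 2 * dot u v + norm v
  norm-⊕ []      []      = refl
  norm-⊕ (x ∷ u) (y ∷ v) = trans (cong (λ n → (x + y) * (x + y) + n) (norm-⊕ u v)) (eq x y (norm u) (dot u v) (norm v))
    where
    eq : ∀ x y a b c → (x + y) * (x + y) + (a + + 2 * b + c) ≡ x * x + a + + 2 * (x * y + b) + (y * y + c)
    eq = solve-∀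

  dot-scale : ∀ a b (u v : Vec ℤ d) → dot (scale a u) (scale b v) ≡ a * b * dot u v
  dot-scale a b []      []      = sym (ℤ.*-zeroʳ (a * b))
  dot-scale a b (x ∷ u) (y ∷ v) = trans (cong (λ n → a * x * (b * y) + n) (dot-scale a b u v)) (eq a b x y (dot u v))
    where
    eq : ∀ a b x y n → a * x * (b * y) + a * b * n ≡ a * b * (x * y + n)
    eq = solve-∀

  norm-residue : ∀ k .{{_ : ℕ.NonZero k}} (w : Vec ℤ d) → + k ∣ norm w → + k ∣ norm (residue k w)
  norm-residue k w k∣ = ∣m+n∣n⇒∣m {m = norm r} {+ k * (+ 2 * dot r t + + k * norm t)}
    (subst (+ k ∣_) norm-w k∣) (divides (+ 2 * dot r t + + k * norm t) (ℤ.*-comm (+ k) (+ 2 * dot r t + + k * norm t)))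
    where
    r = residue k w
    t = quotients k w
    eq : ∀ k a b c → a + + 2 * (+ 1 * k * b) + k * k * c ≡ a + k * (+ 2 * b + k * c)
    eq = solve-∀
    norm-w : norm w ≡ norm r + + k * (+ 2 * dot r t + + k * norm t)
    norm-w = begin
      norm w
        ≡⟨ cong norm (residue-⊕-quotients k w) ⟩
      norm (r ⊕ scale (+ k) t)                                           ≡⟨ norm-⊕ r (scale (+ k) t) ⟩
      norm r + + 2 * dot r (scale (+ k) t) + norm (scale (+ k) t)
        ≡⟨ cong₂ (λ a b → norm r + + 2 * a + b)
             (trans (cong (λ u → dot u (scale (+ k) t)) (sym (scale-1 r))) (dot-scale (+ 1) (+ k) r t))
             (norm-scale (+ k) t) ⟩
      norm r + + 2 * (+ 1 * + k * dot r t) + + k * + k * norm t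
        ≡⟨ eq (+ k) (norm r) (dot r t) (norm t) ⟩
      norm r + + k * (+ 2 * dot r t + + k * norm t)                      ∎

  -- If 5 divides every coordinate of w, then w mod 25 determines norm w mod 125.
  norm-residue₁₂₅ : ∀ (w : Vec ℤ d) → Divisible 5 (residue 25 w) → ∃ λ e → norm w ≡ norm (residue 25 w) + e * + 125
  norm-residue₁₂₅ w 5∣r with divisible-quotient 5∣r
  ... | u , r≡5u = + 2 * dot u t + + 5 * norm t , (begin
      norm w                                                      ≡⟨ cong norm (residue-⊕-quotients 25 w) ⟩
      norm (r ⊕ scale (+ 25) t)                                   ≡⟨ norm-⊕ r (scale (+ 25) t) ⟩
      norm r + + 2 * dot r (scale (+ 25) t) + norm (scale (+ 25) t)
        ≡⟨ cong₂ (λ a b → norm r + + 2 * a + b)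
             (trans (cong (λ r → dot r (scale (+ 25) t)) r≡5u) (dot-scale (+ 5) (+ 25) u t)) (norm-scale (+ 25) t) ⟩
      norm r + + 2 * (+ 125 * dot u t) + + 625 * norm t           ≡⟨ eq (norm r) (dot u t) (norm t) ⟩
      norm r + (+ 2 * dot u t + + 5 * norm t) * + 125             ∎)
    where
    r = residue 25 w
    t = quotients 25 w
    eq : ∀ a b c → a + + 2 * (+ 125 * b) + + 625 * c ≡ a + (+ 2 * b + + 5 * c) * + 125
    eq = solve-∀

  -- Up to units, 1 ± 2i, 1 ± 2j and 1 ± 2k are all the Hurwitz quaternions of norm 5.
  quaternions₅ : List (Similitude 4 5)
  quaternions₅ = R ∷ inverse R ∷ conjugate ρ R ∷ conjugate ρ (inverse R) ∷
    conjugate ρ (conjugate ρ R) ∷ conjugate ρ (conjugate ρ (inverse R)) ∷ []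
    where
    R = leftMultiplication₅
    ρ = rotation₄

  conjugations₂₅ : List (Similitude 3 25)
  conjugations₂₅ = R ∷ inverse R ∷ conjugate ρ R ∷ conjugate ρ (inverse R) ∷
    conjugate ρ (conjugate ρ R) ∷ conjugate ρ (conjugate ρ (inverse R)) ∷ []
    where
    R = conjugation₂₅
    ρ = rotation₃

  -- Multiplication by 5, taken four times, lowers imageCount by 1 mod 5 exactly at the vectors divisible by 5.
  scaledConjugations₂₅ : List (Similitude 3 25)
  scaledConjugations₂₅ = replicate 4 scaling₂₅ ++ conjugations₂₅

  abstract
    -- Modulo 5 the quaternions are the 2 × 2 matrices over 𝔽₅, with norm the determinant, and the
    -- six images consist of the matrices whose columns lie in one of the six lines of the plane. A
    -- singular nonzero matrix lies in exactly one image and zero lies in all six; both counts are 1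
    -- modulo 5. The code evaluates all 5⁴ residues.
    imageCount-quaternions₅ : ListAll.All (λ r → + 5 ∣ norm r → imageCount quaternions₅ r % 5 ≡ 1) (residues 4 5)
    imageCount-quaternions₅ = toWitness
      {a? = ListAll.all? (λ r → (+ 5 ∣? norm r) →-dec (imageCount quaternions₅ r % 5 ℕ.≟ 1)) (residues 4 5)} _

    -- A vector not divisible by 5 lies in exactly one image. A vector 5u lies in as many as u,
    -- viewed as a trace-zero matrix over 𝔽₅, has eigenlines. If 125 divides its norm, u is
    -- nilpotent, with one eigenline, or zero, with six. The hypothesis on 125 is restricted to
    -- multiples of 5 because only for these is it determined by the residue modulo 25.
    imageCount-conjugations₂₅ : ListAll.All
      (λ r → + 25 ∣ norm r → (Divisible 5 r → + 125 ∣ norm r) → imageCount conjugations₂₅ r % 5 ≡ 1) (residues 3 25)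
    imageCount-conjugations₂₅ = toWitness
      {a? = ListAll.all? (λ r → (+ 25 ∣? norm r) →-dec ((divisible? 5 r →-dec (+ 125 ∣? norm r)) →-dec
                                (imageCount conjugations₂₅ r % 5 ℕ.≟ 1))) (residues 3 25)} _

    -- Norms 25 and 100 modulo 125 mean r = 5u with norm u ≡ ±1 mod 5. Then -norm u is a nonzero
    -- square, u has two eigenlines, and the four scalings bring the count to 6. A vector not
    -- divisible by 5 is in the image of no scaling and keeps the count 1.
    imageCount-scaled : ListAll.All
      (λ r → + 25 ∣ norm r → (Divisible 5 r → + 125 ∣ norm r - + 25 ⊎ + 125 ∣ norm r - + 100) →
             imageCount scaledConjugations₂₅ r % 5 ≡ 1) (residues 3 25)
    imageCount-scaled = toWitness
      {a? = ListAll.all? (λ r →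
        (+ 25 ∣? norm r) →-dec
        ((divisible? 5 r →-dec ((+ 125 ∣? norm r - + 25) ⊎-dec (+ 125 ∣? norm r - + 100))) →-dec
        (imageCount scaledConjugations₂₅ r % 5 ℕ.≟ 1))) (residues 3 25)} _

  norm-∈ : ∀ {n} {b : Vec ℤ d} → b ∈ oddSquares d n → norm (odd b) ≡ + (8 ℕ.* n ℕ.+ d)
  norm-∈ {b = b} b∈ = trans (norm-odd b) (cong (λ w → + (8 ℕ.* w ℕ.+ _)) (∈-oddSquares⁻ b∈))

  +∣ : ∀ k m {n} → n ≡ m ℕ.* k → + k ∣ + n
  +∣ k m refl = divides (+ m) (ℤ.pos-* m k)

  oddSquares₄ : ∀ n → + length (oddSquares 4 (n ℕ.* 5 ℕ.+ 2)) ≋ + length (oddSquares 4 n)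
  oddSquares₄ n = K.trans (hecke {4} {2} quaternions₅ (eq₁ n) count)
    -- Six quaternions give the factor 6 = 1 + 5.
    (congruent (+ L) (trans (ℤ.pos-* 6 L) (eq₂ (+ L))))
    where
    L = length (oddSquares 4 n)
    eq₁ : ∀ n → 8 ℕ.* (n ℕ.* 5 ℕ.+ 2) ℕ.+ 4 ≡ 5 ℕ.* (8 ℕ.* n ℕ.+ 4)
    eq₁ = ℕ-Solver.solve-∀
    eq₂ : ∀ a → + 6 * a ≡ a + a * + 5
    eq₂ = solve-∀
    count : ∀ {b} → b ∈ oddSquares 4 (n ℕ.* 5 ℕ.+ 2) → imageCount quaternions₅ (odd b) % 5 ≡ 1
    count {b} b∈ = trans (cong (_% 5) (imageCount-residue quaternions₅ (odd b)))
      (ListAll.lookup imageCount-quaternions₅ (∈-residues 5 (odd b)) (norm-residue 5 (odd b)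
        (subst (+ 5 ∣_) (sym (norm-∈ b∈)) (+∣ 5 (8 ℕ.* n ℕ.+ 4) (trans (eq₁ n) (ℕ.*-comm 5 (8 ℕ.* n ℕ.+ 4)))))))

  private
    8[25n+9]+3 : ∀ n → 8 ℕ.* (25 ℕ.* n ℕ.+ 9) ℕ.+ 3 ≡ 25 ℕ.* (8 ℕ.* n ℕ.+ 3)
    8[25n+9]+3 = ℕ-Solver.solve-∀

    25∣norm : ∀ n {b} → b ∈ oddSquares 3 (25 ℕ.* n ℕ.+ 9) → + 25 ∣ norm (residue 25 (odd b))
    25∣norm n {b} b∈ = norm-residue 25 (odd b)
      (subst (+ 25 ∣_) (sym (norm-∈ b∈)) (+∣ 25 (8 ℕ.* n ℕ.+ 3) (trans (8[25n+9]+3 n) (ℕ.*-comm 25 (8 ℕ.* n ℕ.+ 3)))))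

    norm-residue≡ : ∀ {b : Vec ℤ 3} n m c → b ∈ oddSquares 3 n → 8 ℕ.* n ℕ.+ 3 ≡ 125 ℕ.* m ℕ.+ c →
      Divisible 5 (residue 25 (odd b)) → + 125 ∣ norm (residue 25 (odd b)) - + c
    norm-residue≡ {b} n m c b∈ n≡ 5∣r with norm-residue₁₂₅ (odd b) 5∣r
    ... | e , norm≡ = divides (+ m - e) (eq (norm (residue 25 (odd b))) (+ m) (+ c) e (begin
      norm (residue 25 (odd b)) + e * + 125   ≡⟨ norm≡ ⟨
      norm (odd b)                            ≡⟨ norm-∈ b∈ ⟩
      + (8 ℕ.* n ℕ.+ 3)                       ≡⟨ cong +_ n≡ ⟩
      + (125 ℕ.* m ℕ.+ c)                     ≡⟨ cong (λ p → p + + c) (ℤ.pos-* 125 m) ⟩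
      + 125 * + m + + c                       ∎))
      where
      eq₁ : ∀ r c e → r - c ≡ r + e * + 125 - e * + 125 - c
      eq₁ = solve-∀
      eq₂ : ∀ m c e → + 125 * m + c - e * + 125 - c ≡ (m - e) * + 125
      eq₂ = solve-∀
      eq : ∀ r m c e → r + e * + 125 ≡ + 125 * m + c → r - c ≡ (m - e) * + 125
      eq r m c e r≡ = trans (eq₁ r c e) (trans (cong (λ s → s - e * + 125 - c) r≡) (eq₂ m c e))

  -- The class n = 5m + 4 is the one with 5 dividing 8n + 3, so 125 divides 25(8n + 3). The six
  -- conjugations give the factor 6 ≡ 1.
  oddSquares₃-periodic : ∀ m → let n = 5 ℕ.* m ℕ.+ 4 in
    + length (oddSquares 3 (25 ℕ.* n ℕ.+ 9)) ≋ + length (oddSquares 3 n)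
  oddSquares₃-periodic m = K.trans (hecke {3} {12} conjugations₂₅ (8[25n+9]+3 n) count)
    (congruent (+ L) (trans (ℤ.pos-* 6 L) (eq₂ (+ L))))
    where
    n = 5 ℕ.* m ℕ.+ 4
    L = length (oddSquares 3 n)
    eq₂ : ∀ a → + 6 * a ≡ a + a * + 5
    eq₂ = solve-∀
    eq₄ : ∀ m → 8 ℕ.* (25 ℕ.* (5 ℕ.* m ℕ.+ 4) ℕ.+ 9) ℕ.+ 3 ≡ 125 ℕ.* (8 ℕ.* m ℕ.+ 7) ℕ.+ 0
    eq₄ = ℕ-Solver.solve-∀
    count : ∀ {b} → b ∈ oddSquares 3 (25 ℕ.* n ℕ.+ 9) → imageCount conjugations₂₅ (odd b) % 5 ≡ 1
    count {b} b∈ = trans (cong (_% 5) (imageCount-residue conjugations₂₅ (odd b)))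
      (ListAll.lookup imageCount-conjugations₂₅ (∈-residues 25 (odd b)) (25∣norm n b∈)
        λ 5∣r → subst (+ 125 ∣_) (ℤ.+-identityʳ _) (norm-residue≡ (25 ℕ.* n ℕ.+ 9) (8 ℕ.* m ℕ.+ 7) 0 b∈ (eq₄ m) 5∣r))

  -- Six conjugations and four scalings give the factor 10 ≡ 0. For 8n + 3 ≡ 1 or 4 mod 5 the norm
  -- 25(8n + 3) is 25 or 100 modulo 125.
  oddSquares₃-vanishing : ∀ n m → 8 ℕ.* n ℕ.+ 3 ≡ 5 ℕ.* m ℕ.+ 1 ⊎ 8 ℕ.* n ℕ.+ 3 ≡ 5 ℕ.* m ℕ.+ 4 →
    + length (oddSquares 3 (25 ℕ.* n ℕ.+ 9)) ≋ + 0
  oddSquares₃-vanishing n m n≡ = K.trans (hecke {3} {12} scaledConjugations₂₅ (8[25n+9]+3 n) count)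
    (congruent (+ 2 * + L) (trans (ℤ.pos-* 10 L) (eq₂ (+ L))))
    where
    L = length (oddSquares 3 n)
    eq₂ : ∀ a → + 10 * a ≡ + 0 + + 2 * a * + 5
    eq₂ = solve-∀
    eq₄ : ∀ m c → 25 ℕ.* (5 ℕ.* m ℕ.+ c) ≡ 125 ℕ.* m ℕ.+ 25 ℕ.* c
    eq₄ = ℕ-Solver.solve-∀
    norm≡ : ∀ {c} → 8 ℕ.* n ℕ.+ 3 ≡ 5 ℕ.* m ℕ.+ c → 8 ℕ.* (25 ℕ.* n ℕ.+ 9) ℕ.+ 3 ≡ 125 ℕ.* m ℕ.+ 25 ℕ.* c
    norm≡ {c} eq = trans (8[25n+9]+3 n) (trans (cong (25 ℕ.*_) eq) (eq₄ m c))
    count : ∀ {b} → b ∈ oddSquares 3 (25 ℕ.* n ℕ.+ 9) → imageCount scaledConjugations₂₅ (odd b) % 5 ≡ 1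
    count {b} b∈ = trans (cong (_% 5) (imageCount-residue scaledConjugations₂₅ (odd b)))
      (ListAll.lookup imageCount-scaled (∈-residues 25 (odd b)) (25∣norm n b∈) λ 5∣r → cases 5∣r n≡)
      where
      cases : Divisible 5 (residue 25 (odd b)) → _ → _
      cases 5∣r (inj₁ eq) = inj₁ (norm-residue≡ (25 ℕ.* n ℕ.+ 9) m 25 b∈ (norm≡ eq) 5∣r)
      cases 5∣r (inj₂ eq) = inj₂ (norm-residue≡ (25 ℕ.* n ℕ.+ 9) m 100 b∈ (norm≡ eq) 5∣r)

-- From sums of three odd squares to pod

open import Defs
open import Data.Nat.Base using (ℕ; _+_; _*_; _^_; _/_; _≥_)
open import Data.Nat.Divisibility using (_∣_)
open import Data.Product.Base using (_×_)
open CharacteristicFive renaming (_+_ to _+ˢ_; _*_ to _*ˢ_; _^_ to _^ˢ_)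
open SignedPod
open Dissection
open OddSquares
open Hecke

-- 2⁴ ≡ 1 removes the factor 2ᵈ coming from the signs: it is 1 for d = 4, and for d = 3 its inverse
-- is 2, the factor in `ψ³-coeff`.
16≈1 : ∀ f → const (+ 16) *ˢ f ≈ f
16≈1 f = coeffwise λ n → K.trans (const-*-coeff (+ 16) f n)
  (K.trans (K.*-congʳ {f n} 16≋1) (K.*-identityˡ (f n)))
  where
  16≋1 : + 16 ≋ + 1
  16≋1 = congruent (+ 3) refl

ψ⁴-coeff : ∀ n → (ψ ^ˢ 4) n ≋ + length (oddSquares 4 n)
ψ⁴-coeff n = begin
  (ψ ^ˢ 4) n                                ≈⟨ coeff (16≈1 (ψ ^ˢ 4)) n ⟨
  (const (+ 16) *ˢ ψ ^ˢ 4) n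
    ≈⟨ coeff (solve 1 (λ p → con (+ 16) :* p :^ 4 := (p :+ p) :^ 4) S.refl ψ) n ⟩
  ((ψ +ˢ ψ) ^ˢ 4) n                         ≈⟨ length-oddSquares 4 n ⟨
  + length (oddSquares 4 n)                 ∎
  where
  open Solver₅
  open ≈-Reasoning K.setoid

ψ³-coeff : ∀ n → (ψ ^ˢ 3) n ≋ + 2 ℤ.* + length (oddSquares 3 n)
ψ³-coeff n = begin
  (ψ ^ˢ 3) n                                ≈⟨ coeff (16≈1 (ψ ^ˢ 3)) n ⟨
  (const (+ 16) *ˢ ψ ^ˢ 3) n
    ≈⟨ coeff (solve 1 (λ p → con (+ 16) :* p :^ 3 := con (+ 2) :* (p :+ p) :^ 3) S.refl ψ) n ⟩
  (const (+ 2) *ˢ (ψ +ˢ ψ) ^ˢ 3) n          ≈⟨ const-*-coeff (+ 2) ((ψ +ˢ ψ) ^ˢ 3) n ⟩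
  + 2 ℤ.* ((ψ +ˢ ψ) ^ˢ 3) n                 ≈⟨ K.*-congˡ {+ 2} (length-oddSquares 3 n) ⟨
  + 2 ℤ.* + length (oddSquares 3 n)         ∎
  where
  open Solver₅
  open ≈-Reasoning K.setoid

signedPod-5n+2 : ∀ n → signedPod (n * 5 + 2) ≋ + 2 ℤ.* + length (oddSquares 3 n)
signedPod-5n+2 n = K.trans (coeff (U-signedPod Uψ⁴≈ψ⁴) n) (ψ³-coeff n)
  where
  Uψ⁴≈ψ⁴ : U (ψ ^ˢ 4) S.≈ ψ ^ˢ 4
  Uψ⁴≈ψ⁴ = coeffwise λ n → K.trans (ψ⁴-coeff (n * 5 + 2)) (K.trans (oddSquares₄ n) (K.sym (ψ⁴-coeff n)))

∣sign∣ : ∀ n → ℤ.∣ sign n ∣ ≡ 1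
∣sign∣ zero    = refl
∣sign∣ (suc n) = trans (ℤ.∣-i∣≡∣i∣ (sign n)) (∣sign∣ n)

signedPod≋0⇒5∣pod : ∀ n → signedPod n ≋ + 0 → 5 ∣ pod n
signedPod≋0⇒5∣pod n (congruent s eq) = ℕ.divides ℤ.∣ s ∣ (begin
  pod n                          ≡⟨ ℕ.*-identityˡ (pod n) ⟨
  1 * pod n                      ≡⟨ cong (_* pod n) (∣sign∣ n) ⟨
  ℤ.∣ sign n ∣ * pod n           ≡⟨ ℤ.abs-* (sign n) (+ pod n) ⟨
  ℤ.∣ signedPod n ∣              ≡⟨ cong ℤ.∣_∣ (trans eq (ℤ.+-identityˡ (s ℤ.* + 5))) ⟩
  ℤ.∣ s ℤ.* + 5 ∣                ≡⟨ ℤ.abs-* s (+ 5) ⟩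
  ℤ.∣ s ∣ * 5                    ∎)
  where open ≡-Reasoning

-- The map n ↦ 25n + 9 is multiplication by 25 on N = 8n + 3, so `offset c α` is the n belonging to
-- N = 25^α (8c + 3).
offset : ℕ → ℕ → ℕ
offset c zero    = c
offset c (suc α) = 25 * offset c α + 9

-- 8 index c n α + 3 = 25^α (40n + 8c + 3)
index : ℕ → ℕ → ℕ → ℕ
index c n α = 5 ^ (2 * α + 1) * n + offset c α

5^[2[1+α]+1] : ∀ α → 5 ^ (2 * suc α + 1) ≡ 25 * 5 ^ (2 * α + 1)
5^[2[1+α]+1] α = trans (cong (λ e → 5 ^ (e + 1)) (ℕ.*-suc 2 α)) (sym (ℕ.*-assoc 5 5 (5 ^ (2 * α + 1))))

index-suc : ∀ c n α → index c n (suc α) ≡ 25 * index c n α + 9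
index-suc c n α = trans (cong (λ p → p * n + offset c (suc α)) (5^[2[1+α]+1] α)) (eq (5 ^ (2 * α + 1)) n (offset c α))
  where
  eq : ∀ p n o → 25 * p * n + (25 * o + 9) ≡ 25 * (p * n + o) + 9
  eq = ℕ-Solver.solve-∀

-- For any o, 8(5o + 2) = 5(8o + 3) + 1; at `offset c α` the factor 8o + 3 is 25^α (8c + 3).
offset-closed : ∀ c α → (offset c α * 5 + 2) * 8 ≡ (8 * c + 3) * 5 ^ (2 * α + 1) + 1
offset-closed c zero    = eq c
  where
  eq : ∀ c → (c * 5 + 2) * 8 ≡ (8 * c + 3) * 5 + 1
  eq = ℕ-Solver.solve-∀
-- Both sides minus 1 are multiplied by 25 at each step. Adding 24 = 25 - 1 expresses this without
-- subtraction.
offset-closed c (suc α) = ℕ.+-cancelʳ-≡ 24 _ _ (begin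
  ((25 * o + 9) * 5 + 2) * 8 + 24                   ≡⟨ eq₁ o ⟩
  25 * ((o * 5 + 2) * 8)                            ≡⟨ cong (25 *_) (offset-closed c α) ⟩
  25 * ((8 * c + 3) * p + 1)                        ≡⟨ eq₂ c p ⟩
  (8 * c + 3) * (25 * p) + 1 + 24                   ≡⟨ cong (λ p → (8 * c + 3) * p + 1 + 24) (5^[2[1+α]+1] α) ⟨
  (8 * c + 3) * 5 ^ (2 * suc α + 1) + 1 + 24        ∎)
  where
  open ≡-Reasoning
  o = offset c α
  p = 5 ^ (2 * α + 1)
  eq₁ : ∀ o → ((25 * o + 9) * 5 + 2) * 8 + 24 ≡ 25 * ((o * 5 + 2) * 8)
  eq₁ = ℕ-Solver.solve-∀
  eq₂ : ∀ c p → 25 * ((8 * c + 3) * p + 1) ≡ (8 * c + 3) * (25 * p) + 1 + 24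
  eq₂ = ℕ-Solver.solve-∀

index-argument : ∀ c n α → index c n α * 5 + 2 ≡ 5 ^ (2 * α + 2) * n + ((8 * c + 3) * 5 ^ (2 * α + 1) + 1) / 8
index-argument c n α = begin
  (5 ^ (2 * α + 1) * n + o) * 5 + 2                                     ≡⟨ eq (5 ^ (2 * α + 1)) n o ⟩
  5 ^ suc (2 * α + 1) * n + (o * 5 + 2)
    ≡⟨ cong₂ (λ e s → 5 ^ e * n + s) (sym (ℕ.+-suc (2 * α) 1)) (sym (m*n/n≡m (o * 5 + 2) 8)) ⟩
  5 ^ (2 * α + 2) * n + (o * 5 + 2) * 8 / 8
    ≡⟨ cong (λ s → 5 ^ (2 * α + 2) * n + s / 8) (offset-closed c α) ⟩
  5 ^ (2 * α + 2) * n + ((8 * c + 3) * 5 ^ (2 * α + 1) + 1) / 8         ∎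
  where
  open ≡-Reasoning
  o = offset c α
  eq : ∀ p n o → (p * n + o) * 5 + 2 ≡ 5 * p * n + (o * 5 + 2)
  eq = ℕ-Solver.solve-∀

-- The first factor 25 gives zero by `oddSquares₃-vanishing`. From there on 8i + 3 is divisible by
-- 5, so each further factor falls under `oddSquares₃-periodic`.
oddSquares₃-index : ∀ c n m → 8 * (5 * n + c) + 3 ≡ 5 * m + 1 ⊎ 8 * (5 * n + c) + 3 ≡ 5 * m + 4 →
  ∀ α → + length (oddSquares 3 (index c n (suc α))) ≋ + 0
oddSquares₃-index c n m n≡ zero = subst (λ i → + length (oddSquares 3 i) ≋ + 0) (sym (index-suc c n 0))
  (oddSquares₃-vanishing (5 * n + c) m n≡)
oddSquares₃-index c n m n≡ (suc α) = K.trans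
  (subst (λ i → + length (oddSquares 3 (index c n (2 + α))) ≋ + length (oddSquares 3 i)) (sym i≡) periodic)
  (oddSquares₃-index c n m n≡ α)
  where
  x = 5 * index c n α + 1
  eq : ∀ i → 25 * i + 9 ≡ 5 * (5 * i + 1) + 4
  eq = ℕ-Solver.solve-∀
  i≡ : index c n (suc α) ≡ 5 * x + 4
  i≡ = trans (index-suc c n α) (eq (index c n α))
  periodic : + length (oddSquares 3 (index c n (2 + α))) ≋ + length (oddSquares 3 (5 * x + 4))
  periodic = subst (λ i → + length (oddSquares 3 i) ≋ + length (oddSquares 3 (5 * x + 4)))
    (sym (trans (index-suc c n (suc α)) (cong (λ i → 25 * i + 9) i≡))) (oddSquares₃-periodic x)

5∣pod : ∀ c n m → 8 * (5 * n + c) + 3 ≡ 5 * m + 1 ⊎ 8 * (5 * n + c) + 3 ≡ 5 * m + 4 → ∀ α → α ≥ 1 →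
  5 ∣ pod (5 ^ (2 * α + 2) * n + ((8 * c + 3) * 5 ^ (2 * α + 1) + 1) / 8)
5∣pod c n m n≡ (suc α) (s≤s _) = subst (λ i → 5 ∣ pod i) (index-argument c n (suc α))
  (signedPod≋0⇒5∣pod (index c n (suc α) * 5 + 2) (K.trans (signedPod-5n+2 (index c n (suc α)))
    (K.*-congˡ {+ 2} (oddSquares₃-index c n m n≡ α))))

theorem4 : (n α : ℕ) → α ≥ 1 →
    (5 ∣ pod (5 ^ (2 * α + 2) * n + (11 * 5 ^ (2 * α + 1) + 1) / 8)) ×
    (5 ∣ pod (5 ^ (2 * α + 2) * n + (19 * 5 ^ (2 * α + 1) + 1) / 8))
-- c = 1 gives 8c + 3 = 11 ≡ 1 and c = 2 gives 8c + 3 = 19 ≡ 4 modulo 5, which selects the two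
-- alternatives.
theorem4 n α α≥1 = 5∣pod 1 n (8 * n + 2) (inj₁ (eq₁ n)) α α≥1 , 5∣pod 2 n (8 * n + 3) (inj₂ (eq₂ n)) α α≥1
  where
  eq₁ : ∀ n → 8 * (5 * n + 1) + 3 ≡ 5 * (8 * n + 2) + 1
  eq₁ = ℕ-Solver.solve-∀
  eq₂ : ∀ n → 8 * (5 * n + 2) + 3 ≡ 5 * (8 * n + 3) + 4
  eq₂ = ℕ-Solver.solve-∀
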